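{- Let $P$ be a column-strict tableau of skew partition shape with entries from $[k]$, and let $j$ be the number of columns of $P$ whose top cell lies in a row higher than the top cell of the first (leftmost) column of $P$. Then the $j$th iterate $\mathcal{X}^j(P)$ of column extraction applied to $P$ is the rectification of $P$.
   Context: Tableaux are column-strict fillings of skew shapes $\lambda/\mu$. Cross order: $c\prec d$ if cell $c$ lies in the same column as, or a column to the right of, $d$ and in a row above $d$. A column slide beginning at an inner corner $b$ moves the empty box $b$: it first switches with the first $1$ greater than it in the cross order, then with the first $2$ greater in the cross order, and so on, ending when it switches with a $k$; it is permissible when there is a chain of entries $1,2,\dots,k$ increasing in the cross order from $b$. Column extraction: form $P'$ by placing a full column with entries $1,\dots,k$ immediately to the left of the first column of $P$, beginning in the same row as that column; begin a column slide at the cell just above the rightmost column of $P'$, then at the cell just above that, and so on (at most $k$ times) until the rightmost column is full; delete that full column to obtain $\mathcal{X}(P)$. The rectification of $P$ is the unique tableau of (straight) partition shape obtainable from $P$ by jeu de taquin slides, i.e. the unique partition-shape tableau Knuth-equivalent to $P$ (positioned up to translation). -}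

module Defs where

open import Data.Nat as ℕ using (ℕ; zero; suc)
open import Data.Integer as ℤ using (ℤ; +_)
open import Data.Product using (Σ; ∃; ∃-syntax; _×_; _,_; proj₁; proj₂)
open import Data.Maybe using (Maybe; just; nothing)
open import Data.List using (List; []; _∷_; _++_; length; upTo; reverse; concatMap)
open import Data.List.Membership.Propositional using (_∈_)
open import Data.List.Relation.Unary.Unique.Propositional using (Unique)
open import Relation.Binary.PropositionalEquality using (_≡_; _≢_)
open import Relation.Nullary using (¬_)
open import Function.Bundles using (_⇔_)

-- Cells and fillings.  A cell is (row , column) in ℤ × ℤ, English
-- convention: row indices increase downwards, column indices increase
-- to the right.  A filling assigns to each cell either nothing (the
-- cell is not in the shape) or an entry.

Cell : Set
Cell = ℤ × ℤ

row col : Cell → ℤ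
row = proj₁
col = proj₂

Filling : Set
Filling = Cell → Maybe ℕ

Occ : Filling → Cell → Set
Occ F e = ∃[ a ] (F e ≡ just a)

Nonempty : Filling → Set
Nonempty F = ∃[ e ] Occ F e

part : List ℕ → ℕ → ℕ
part []       _       = 0
part (x ∷ _)  zero    = x
part (_ ∷ xs) (suc i) = part xs i

IsPartition : List ℕ → Set
IsPartition λ′ = ∀ i → part λ′ (suc i) ℕ.≤ part λ′ i

_⊆ₚ_ : List ℕ → List ℕ → Set
μ ⊆ₚ λ′ = ∀ i → part μ i ℕ.≤ part λ′ i

InSkew : List ℕ → List ℕ → ℤ → ℤ → Cell → Set
InSkew λ′ μ r0 c0 (r , c) =
  ∃[ i ] ∃[ j ] (r ≡ r0 ℤ.+ + i) × (c ≡ c0 ℤ.+ + j)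
               × (part μ i ℕ.≤ j) × (j ℕ.< part λ′ i)

SkewShaped : Filling → Set
SkewShaped F = ∃[ λ′ ] ∃[ μ ] ∃[ r0 ] ∃[ c0 ]
  IsPartition λ′ × IsPartition μ × (μ ⊆ₚ λ′) ×
  (∀ e → Occ F e ⇔ InSkew λ′ μ r0 c0 e)

StraightShaped : Filling → Set
StraightShaped F = ∃[ λ′ ] ∃[ r0 ] ∃[ c0 ]
  IsPartition λ′ × (∀ e → Occ F e ⇔ InSkew λ′ [] r0 c0 e)

ColumnStrict : Filling → Set
ColumnStrict F =
  (∀ r c a b → F (r , c) ≡ just a → F (r , c ℤ.+ + 1) ≡ just b → a ℕ.≤ b) ×
  (∀ r c a b → F (r , c) ≡ just a → F (r ℤ.+ + 1 , c) ≡ just b → a ℕ.< b)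

EntriesIn : ℕ → Filling → Set
EntriesIn k F = ∀ e a → F e ≡ just a → (1 ℕ.≤ a) × (a ℕ.≤ k)

Tableau : ℕ → Filling → Set
Tableau k F = SkewShaped F × ColumnStrict F × EntriesIn k F

maybeToList : Maybe ℕ → List ℕ
maybeToList nothing  = []
maybeToList (just a) = a ∷ []

boxWord : Filling → ℤ → ℕ → ℤ → ℕ → List ℕ
boxWord F rlo h clo w =
  concatMap (λ i → concatMap (λ j → maybeToList (F (rlo ℤ.+ + i , clo ℤ.+ + j))) (upTo w))
            (reverse (upTo h))

InBox : ℤ → ℕ → ℤ → ℕ → Cell → Set
InBox rlo h clo w (r , c) =
  ∃[ i ] ∃[ j ] (i ℕ.< h) × (j ℕ.< w) × (r ≡ rlo ℤ.+ + i) × (c ≡ clo ℤ.+ + j)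

-- w is the reading word of F (independent of the chosen box)
ReadingWord : Filling → List ℕ → Set
ReadingWord F u = ∃[ rlo ] ∃[ h ] ∃[ clo ] ∃[ w ]
  (∀ e → Occ F e → InBox rlo h clo w e) × (u ≡ boxWord F rlo h clo w)

data _≈K_ : List ℕ → List ℕ → Set where
  krefl  : ∀ {u} → u ≈K u
  ksym   : ∀ {u v} → u ≈K v → v ≈K u
  ktrans : ∀ {u v w} → u ≈K v → v ≈K w → u ≈K w
  knuth₁ : ∀ u v {x y z} → x ℕ.< y → y ℕ.≤ z →
           (u ++ y ∷ z ∷ x ∷ v) ≈K (u ++ y ∷ x ∷ z ∷ v)
  knuth₂ : ∀ u v {x y z} → x ℕ.≤ y → y ℕ.< z →
           (u ++ x ∷ z ∷ y ∷ v) ≈K (u ++ z ∷ x ∷ y ∷ v)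

-- Q is (a translate of) the rectification of P: Q is a column-strict
-- tableau of straight partition shape Knuth equivalent to P
IsRectification : Filling → Filling → Set
IsRectification P Q =
  StraightShaped Q × ColumnStrict Q ×
  ∃[ u ] ∃[ v ] ReadingWord P u × ReadingWord Q v × (u ≈K v)

_≺_ : Cell → Cell → Set
c ≺ d = (col d ℤ.≤ col c) × (row c ℤ.< row d)

-- weak version (rows weakly above); used only to single out the
-- "first" element, breaking ties inside a row in favour of the
-- rightmost cell
_≼_ : Cell → Cell → Set
c ≼ d = (col d ℤ.≤ col c) × (row c ℤ.≤ row d)

FirstGreater : Filling → ℕ → Cell → Cell → Set
FirstGreater F i x d =
  (F d ≡ just i) × (x ≺ d) × (∀ e → F e ≡ just i → x ≺ e → d ≼ e)

ColSlide : ℕ → Filling → Cell → Filling → Set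
ColSlide k F b F′ =
  (F b ≡ nothing) ×
  Σ (ℕ → Cell) λ path → (path 0 ≡ b) ×
    (∀ i → i ℕ.< k → FirstGreater F (suc i) (path i) (path (suc i))) ×
    (∀ i → i ℕ.< k → F′ (path i) ≡ just (suc i)) ×
    (F′ (path k) ≡ nothing) ×
    (∀ e → (∀ i → i ℕ.≤ k → e ≢ path i) → F′ e ≡ F e)

LeftmostCol : Filling → ℤ → Set
LeftmostCol F c = (∃[ r ] Occ F (r , c)) × (∀ r c′ → c′ ℤ.< c → F (r , c′) ≡ nothing)

RightmostCol : Filling → ℤ → Set
RightmostCol F c = (∃[ r ] Occ F (r , c)) × (∀ r c′ → c ℤ.< c′ → F (r , c′) ≡ nothing)

TopRow : Filling → ℤ → ℤ → Set
TopRow F c r = Occ F (r , c) × (∀ r′ → r′ ℤ.< r → F (r′ , c) ≡ nothing)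

AddFullColumn : ℕ → ℤ → ℤ → Filling → Filling → Set
AddFullColumn k c rt F F′ =
  (∀ i → i ℕ.< k → F′ (rt ℤ.+ + i , c ℤ.- + 1) ≡ just (suc i)) ×
  (∀ e → (∀ i → i ℕ.< k → e ≢ (rt ℤ.+ + i , c ℤ.- + 1)) → F′ e ≡ F e)

FullColumn : ℕ → Filling → ℤ → Set
FullColumn k F c = ∃[ r ]
  (∀ i → i ℕ.< k → F (r ℤ.+ + i , c) ≡ just (suc i)) ×
  (∀ r′ → Occ F (r′ , c) → ∃[ i ] (i ℕ.< k) × (r′ ≡ r ℤ.+ + i))

DeleteColumn : ℤ → Filling → Filling → Set
DeleteColumn c F F′ =
  (∀ r → F′ (r , c) ≡ nothing) × (∀ r c′ → c′ ≢ c → F′ (r , c′) ≡ F (r , c′))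

data SlideRun (k : ℕ) (c : ℤ) : ℕ → Filling → Filling → Set where
  stop  : ∀ {T} → FullColumn k T c → SlideRun k c 0 T T
  slide : ∀ {n T T′ U r} → ¬ FullColumn k T c → TopRow T c r →
          ColSlide k T (r ℤ.- + 1 , c) T′ → SlideRun k c n T′ U →
          SlideRun k c (suc n) T U

Extract : ℕ → Filling → Filling → Set
Extract k P Q = ∃[ c₁ ] ∃[ rt ] ∃[ cₘ ] ∃[ P′ ] ∃[ n ] ∃[ T ]
  LeftmostCol P c₁ × TopRow P c₁ rt × RightmostCol P cₘ ×
  AddFullColumn k c₁ rt P P′ ×
  SlideRun k cₘ n P′ T × (n ℕ.≤ k) ×
  DeleteColumn cₘ T Q

data Iterate (R : Filling → Filling → Set) : ℕ → Filling → Filling → Set where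
  iter-zero : ∀ {P} → Iterate R 0 P P
  iter-suc  : ∀ {n P Q U} → R P Q → Iterate R n Q U → Iterate R (suc n) P U

NumHigherColumns : Filling → ℕ → Set
NumHigherColumns P j = ∃[ c₁ ] ∃[ rt ] ∃[ L ]
  LeftmostCol P c₁ × TopRow P c₁ rt × Unique L ×
  (∀ c → (c ∈ L) ⇔ (∃[ r ] TopRow P c r × (r ℤ.< rt))) ×
  (length L ≡ j)

{-# OPTIONS --safe #-}
module Submission where

-- A column is recorded by its top row and the set of its values; column d is
-- counted from the right, and a column slide decreases β d i (the row just
-- below the entries ≤ i of column d) by one at exactly one column for each i.
-- The slides of one extraction form a system of queues in series, the values
-- playing the role of time: the slides are the customers, customer s waits in
-- column d at time i when path s is at column d after passing the value i, and
-- column d serves one customer at each value it does not contain.  All the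
-- intermediate tableaux are therefore given by one recursion, with the number
-- s of slides as the initial queue of the rightmost column, and passing from
-- s to s + 1 adds one customer whose trajectory is the next slide path.
--
-- Looked at one column at a time, the same recursion replaces two neighbouring
-- columns c, e by l, r, where l consists of c and of the letters of e that are
-- unmatched in the bracketing of e against c.  Inserting the letters of c into
-- e shows that the products c e and l r are Knuth equivalent, so extraction
-- preserves the Knuth class.  It keeps the top of the first column and loses
-- the rightmost column, and empty columns stay empty, so the number of higher
-- columns drops until the shape is straight.

open import Defs
open import Data.Bool as Bool using (Bool; true; false; _∨_)
open import Data.Bool.Properties using (T-≡; ∨-zeroʳ)
open import Data.Empty using (⊥-elim)
open import Data.Integer as ℤ using (ℤ; +_)
import Data.Integer.Properties as ℤ
open import Algebra.Properties.AbelianGroup ℤ.+-0-abelianGroup using () renaming (∙-cancelˡ to +-cancelˡ)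
open import Data.Integer.Tactic.RingSolver using (solve-∀)
open import Data.List using (List; []; _∷_; _++_; [_]; length; filter; concatMap; applyUpTo; upTo; downFrom)
open import Data.List.Membership.Propositional using (_∈_)
open import Data.List.Membership.Propositional.Properties using (∈-filter⁺)
open import Data.List.Properties using (++-assoc; ++-identityʳ; filter-notAll; reverse-upTo)
import Data.List.Relation.Unary.Any as Any
open import Data.List.Relation.Unary.Any.Properties using (¬Any[])
open import Data.Maybe using (Maybe; just; nothing; is-just)
open import Data.Maybe.Properties using (just-injective)
open import Data.Nat as ℕ using (ℕ; zero; suc; pred; z≤n; s≤s)
import Data.Nat.Properties as ℕ
open import Data.Product using (Σ; ∃-syntax; _×_; _,_; proj₁; proj₂)
open import Data.Sum using (_⊎_; inj₁; inj₂)
open import Data.Unit using (⊤; tt)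
open import Function.Bundles using (_⇔_; mk⇔; Equivalence)
open import Relation.Binary.Definitions using (tri<; tri≈; tri>)
open import Relation.Binary.PropositionalEquality using (_≡_; _≢_; refl; sym; trans; cong; cong₂; subst; subst₂)
open import Relation.Nullary using (¬_; yes; no)
open import Relation.Nullary.Decidable using (¬?)

-- Knuth equivalence of column words

≡⇒≈K : ∀ {u v} → u ≡ v → u ≈K v
≡⇒≈K refl = krefl

≈K-prefix : ∀ p {u v} → u ≈K v → (p ++ u) ≈K (p ++ v)
≈K-prefix p krefl = krefl
≈K-prefix p (ksym q) = ksym (≈K-prefix p q)
≈K-prefix p (ktrans q r) = ktrans (≈K-prefix p q) (≈K-prefix p r)
≈K-prefix p (knuth₁ u v a b) = subst₂ _≈K_ (++-assoc p u _) (++-assoc p u _) (knuth₁ (p ++ u) v a b)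
≈K-prefix p (knuth₂ u v a b) = subst₂ _≈K_ (++-assoc p u _) (++-assoc p u _) (knuth₂ (p ++ u) v a b)

≈K-suffix : ∀ s {u v} → u ≈K v → (u ++ s) ≈K (v ++ s)
≈K-suffix s krefl = krefl
≈K-suffix s (ksym q) = ksym (≈K-suffix s q)
≈K-suffix s (ktrans q r) = ktrans (≈K-suffix s q) (≈K-suffix s r)
≈K-suffix s (knuth₁ u v a b) = subst₂ _≈K_ (sym (++-assoc u _ s)) (sym (++-assoc u _ s)) (knuth₁ u (v ++ s) a b)
≈K-suffix s (knuth₂ u v a b) = subst₂ _≈K_ (sym (++-assoc u _ s)) (sym (++-assoc u _ s)) (knuth₂ u (v ++ s) a b)

Desc : ℕ → List ℕ → Set
Desc b []       = ⊤
Desc b (x ∷ xs) = x ℕ.< b × Desc x xs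

Asc : ℕ → List ℕ → Set
Asc b []       = ⊤
Asc b (x ∷ xs) = b ℕ.≤ x × Asc x xs

Desc-weaken : ∀ {b b′} xs → b ℕ.≤ b′ → Desc b xs → Desc b′ xs
Desc-weaken []       _ _       = tt
Desc-weaken (x ∷ xs) p (q , r) = ℕ.<-≤-trans q p , r

Asc-weaken : ∀ {b b′} xs → b′ ℕ.≤ b → Asc b xs → Asc b′ xs
Asc-weaken []       _ _       = tt
Asc-weaken (x ∷ xs) p (q , r) = ℕ.≤-trans p q , r

Desc-dropPrefix : ∀ b xs {ys} → Desc b (xs ++ ys) → Desc b ys
Desc-dropPrefix b []       {ys} d       = d
Desc-dropPrefix b (x ∷ xs) {ys} (p , d) = Desc-weaken ys (ℕ.<⇒≤ p) (Desc-dropPrefix x xs d)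

-- The smaller `c` moves left through the row by `yzx` → `yxz`. The letter in front of the crossed
-- one serves as `y`; for the last crossing this is `b`.
letter-past-row : ∀ {b c} M v → c ℕ.< b → Asc b M → (b ∷ M ++ c ∷ v) ≈K (b ∷ c ∷ M ++ v)
letter-past-row []      v c<b _       = krefl
letter-past-row {b} (m ∷ M) v c<b (p , q) =
  ktrans (≈K-prefix [ b ] (letter-past-row M v (ℕ.<-≤-trans c<b p) q))
         (knuth₁ [] (M ++ v) c<b p)

-- Once `c` has passed the row it stands in front of `M` and takes over from `b` as the pivot for
-- the rest of the column.
row-column-swap : ∀ {b} M C → Asc b M → Desc b C → (b ∷ M ++ C) ≈K (b ∷ C ++ M)
row-column-swap {b} M []      _ _       = ≡⇒≈K (cong (b ∷_) (++-identityʳ M))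
row-column-swap {b} M (c ∷ C) a (p , d) =
  ktrans (letter-past-row M C p a)
         (≈K-prefix [ b ] (row-column-swap M C (Asc-weaken M (ℕ.<⇒≤ p) a) d))

-- `z` moves right by `yzx` → `yxz` with the letter before it as `y`; each crossed letter of `S` is
-- the next `y`.
letter-past-column : ∀ {x z} S → x ℕ.≤ z → Desc x S → (x ∷ z ∷ S) ≈K (x ∷ S ++ [ z ])
letter-past-column []      _ _       = krefl
letter-past-column {x} {z} (s ∷ S) p (q , d) =
  ktrans (knuth₁ [] S q p)
         (≈K-prefix [ x ] (letter-past-column S (ℕ.≤-trans (ℕ.<⇒≤ q) p) d))

-- Column words of bit sequences, and the exchange of two neighbouring columns.

opt : Bool → ℕ → List ℕ
opt true  a = [ a ]
opt false a = []

word : (ℕ → Bool) → ℕ → List ℕ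
word b zero    = []
word b (suc i) = opt (b i) (suc i) ++ word b i

-- The column word of the letters i+1, …, i+n.
above : (ℕ → Bool) → ℕ → ℕ → List ℕ
above b i zero    = []
above b i (suc n) = above b (suc i) n ++ opt (b i) (suc i)

above-word : ∀ b i n → above b i n ++ word b i ≡ word b (n ℕ.+ i)
above-word b i zero    = refl
above-word b i (suc n) =
  trans (++-assoc (above b (suc i) n) _ _)
        (trans (above-word b (suc i) n) (cong (word b) (ℕ.+-suc n i)))

above-full : ∀ b n → above b 0 n ≡ word b n
above-full b n = trans (sym (++-identityʳ _))
                       (trans (above-word b 0 n) (cong (word b) (ℕ.+-identityʳ n)))

word-cong : ∀ {b b′} n → (∀ i → i ℕ.< n → b i ≡ b′ i) → word b n ≡ word b′ n
word-cong zero    h = refl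
word-cong (suc n) h = cong₂ (λ x ys → opt x (suc n) ++ ys) (h n (ℕ.n<1+n n))
                            (word-cong n (λ i p → h i (ℕ.m<n⇒m<1+n p)))

-- All letters of `above b i n` exceed `z`, so `x` crosses each of them by `xzy` → `zxy`. The middle
-- letter `y` is the one to the right of the crossed letter: the next smaller letter of the column,
-- or `z` at its end.
letter-past-above : ∀ b n i {x z} S → x ℕ.≤ z → z ℕ.≤ i →
                    (x ∷ above b i n ++ z ∷ S) ≈K (above b i n ++ x ∷ z ∷ S)
letter-past-above b zero    i S _ _ = krefl
letter-past-above b (suc n) i {x} {z} S p q with b i
... | false rewrite ++-identityʳ (above b (suc i) n) =
  letter-past-above b n (suc i) S p (ℕ.m≤n⇒m≤1+n q)
... | true
  rewrite ++-assoc (above b (suc i) n) [ suc i ] (z ∷ S)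
        | ++-assoc (above b (suc i) n) [ suc i ] (x ∷ z ∷ S) =
  ktrans (letter-past-above b n (suc i) (z ∷ S) (ℕ.≤-trans p (ℕ.m≤n⇒m≤1+n q)) ℕ.≤-refl)
         (≈K-prefix (above b (suc i) n) (knuth₂ [] S p (s≤s q)))

-- One value i of a scan: c and e tell whether i lies in the left and in the
-- right column, u is the number of letters < i of the left column that still
-- have to be matched; outL and outR tell whether i lies in the new columns.
outL outR : Bool → Bool → ℕ → Bool
outL true  _     _       = true
outL false true  zero    = true
outL false true  (suc _) = false
outL false false _       = false

outR true  e     _       = e
outR false true  zero    = false
outR false true  (suc _) = true
outR false false _       = false

nextU : Bool → Bool → ℕ → ℕ
nextU true  true  u = u
nextU true  false u = suc u
nextU false true  u = pred u
nextU false false u = u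

-- Column insertion of `x`: the letters of `S` are smaller than `x` and `suc i` is the smallest
-- letter that is at least `x`, so `x` takes its place and `suc i` is bumped out to the right.
pop : ∀ (b : ℕ → Bool) n i p′ x S R → x ℕ.≤ suc i → Desc x S →
      ((p′ ++ [ x ]) ++ (above b (suc i) n ++ [ suc i ]) ++ S ++ R)
      ≈K (p′ ++ above b (suc i) n ++ (x ∷ S) ++ (suc i ∷ R))
pop b n i p′ x S R x≤ d
  rewrite ++-assoc p′ [ x ] ((above b (suc i) n ++ [ suc i ]) ++ S ++ R)
        | ++-assoc (above b (suc i) n) [ suc i ] (S ++ R) =
  ≈K-prefix p′
    (ktrans (letter-past-above b n (suc i) (S ++ R) x≤ ℕ.≤-refl)
       (≈K-prefix (above b (suc i) n)
          (subst ((x ∷ suc i ∷ S ++ R) ≈K_) (cong (x ∷_) (++-assoc S [ suc i ] R))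
                 (≈K-suffix R (letter-past-column S x≤ d)))))

snoc-view : ∀ (z : ℕ) p → ∃[ p′ ] ∃[ x ] (z ∷ p ≡ p′ ++ [ x ]) × (length p′ ≡ length p)
snoc-view z []      = [] , z , refl , refl
snoc-view z (y ∷ p) = let p′ , x , eq , len = snoc-view y p in
  z ∷ p′ , x , cong (z ∷_) eq , cong suc len

-- The common part of the two cases in which `suc i` lies in the right column and a pending letter
-- `x` is matched with it. The bumped `suc i` becomes the next letter of the right output.
serve : ∀ (b : ℕ → Bool) n i p′ x S R A B D → x ℕ.≤ suc i → Desc x S →
        (A ++ p′ ++ above b (suc i) n ++ (x ∷ S) ++ (suc i ∷ R))
        ≈K (B ++ p′ ++ (x ∷ S) ++ D ++ (suc i ∷ R)) →
        (A ++ (p′ ++ [ x ]) ++ (above b (suc i) n ++ [ suc i ]) ++ S ++ R)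
        ≈K (B ++ (p′ ++ [ x ]) ++ S ++ (D ++ [ suc i ]) ++ R)
serve b n i p′ x S R A B D x≤ d ih =
  ktrans (≈K-prefix A (pop b n i p′ x S R x≤ d)) (ktrans ih (≡⇒≈K (cong (B ++_)
    (trans (cong (λ W → p′ ++ x ∷ S ++ W) (sym (++-assoc D [ suc i ] R)))
           (sym (++-assoc p′ [ x ] (S ++ (D ++ [ suc i ]) ++ R)))))))

module Scan (c e : ℕ → Bool) (U : ℕ → ℕ) (U-suc : ∀ i → U (suc i) ≡ nextU (c i) (e i) (U i)) where

  l r : ℕ → Bool
  l i = outL (c i) (e i) (U i)
  r i = outR (c i) (e i) (U i)

  -- The invariant of inserting `c` into `e`, after the values up to `i` have been read. Starting
  -- from empty lists, `p ++ S` is the part of `l` found so far, `R` is the part of `r`, and `p`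
  -- holds the pending letters. On the left-hand side `above e i n ++ S` is the column that receives
  -- the next letter; the smallest pending letter, at the end of `p`, goes first.
  scan : ∀ n i p S R → length p ≡ U i → Desc (suc i) (p ++ S) →
         (above c i n ++ p ++ above e i n ++ S ++ R)
         ≈K (above l i n ++ p ++ S ++ above r i n ++ R)
  scan zero    i p S R _  _ = krefl
  scan (suc n) i p S R eq d with c i | e i | U i | U-suc i
  ... | true | true | u | us
    -- The letter `suc i` of `c` joins the pending ones before one is served. If `p` is empty it is
    -- served itself and bumps the equal letter of `e`.
    with p′ , x , split , len ← snoc-view (suc i) p
    rewrite ++-assoc (above c (suc i) n) [ suc i ] (p ++ (above e (suc i) n ++ [ suc i ]) ++ S ++ R)
          | ++-assoc (above l (suc i) n) [ suc i ] (p ++ S ++ (above r (suc i) n ++ [ suc i ]) ++ R) =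
    subst (λ q → (above c (suc i) n ++ q ++ (above e (suc i) n ++ [ suc i ]) ++ S ++ R)
                 ≈K (above l (suc i) n ++ q ++ S ++ (above r (suc i) n ++ [ suc i ]) ++ R))
          (sym split)
          (serve e n i p′ x S R (above c (suc i) n) (above l (suc i) n) (above r (suc i) n)
             (ℕ.s≤s⁻¹ (proj₁ x-desc)) (proj₂ x-desc)
            (scan n (suc i) p′ (x ∷ S) (suc i ∷ R) (trans len (trans eq (sym us)))
                  desc′))
    where
    desc : Desc (suc (suc i)) (suc i ∷ p ++ S)
    desc = ℕ.≤-refl , d
    desc′ : Desc (suc (suc i)) (p′ ++ x ∷ S)
    desc′ = subst (Desc (suc (suc i))) (trans (cong (_++ S) split) (++-assoc p′ [ x ] S)) desc
    x-desc : Desc (suc (suc i)) (x ∷ S)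
    x-desc = Desc-dropPrefix _ p′ desc′
  ... | true | false | u | us
    rewrite ++-identityʳ (above e (suc i) n) | ++-identityʳ (above r (suc i) n)
          | ++-assoc (above c (suc i) n) [ suc i ] (p ++ above e (suc i) n ++ S ++ R)
          | ++-assoc (above l (suc i) n) [ suc i ] (p ++ S ++ above r (suc i) n ++ R) =
    scan n (suc i) (suc i ∷ p) S R (trans (cong suc eq) (sym us)) (ℕ.≤-refl , d)
  ... | false | false | u | us
    rewrite ++-identityʳ (above e (suc i) n) | ++-identityʳ (above r (suc i) n)
          | ++-identityʳ (above c (suc i) n) | ++-identityʳ (above l (suc i) n) =
    scan n (suc i) p S R (trans eq (sym us)) (Desc-weaken (p ++ S) (ℕ.n≤1+n _) d)
  -- With nothing pending, `suc i` is an unmatched letter of `e`: it moves to the left output by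
  -- joining `S`.
  scan (suc n) i [] S R eq d | false | true | zero | us
    rewrite ++-identityʳ (above c (suc i) n) | ++-identityʳ (above r (suc i) n)
          | ++-assoc (above e (suc i) n) [ suc i ] (S ++ R)
          | ++-assoc (above l (suc i) n) [ suc i ] (S ++ above r (suc i) n ++ R) =
    scan n (suc i) [] (suc i ∷ S) R (sym us) (ℕ.≤-refl , d)
  scan (suc n) i (y ∷ p) S R eq d | false | true | suc u | us
    with p′ , x , split , len ← snoc-view y p
    rewrite ++-identityʳ (above c (suc i) n) | ++-identityʳ (above l (suc i) n) =
    subst (λ q → (above c (suc i) n ++ q ++ (above e (suc i) n ++ [ suc i ]) ++ S ++ R)
                 ≈K (above l (suc i) n ++ q ++ S ++ (above r (suc i) n ++ [ suc i ]) ++ R))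
          (sym split)
          (serve e n i p′ x S R (above c (suc i) n) (above l (suc i) n) (above r (suc i) n)
             (ℕ.<⇒≤ (proj₁ x-desc)) (proj₂ x-desc)
            (scan n (suc i) p′ (x ∷ S) (suc i ∷ R)
                  (trans len (trans (ℕ.suc-injective eq) (sym us)))
                  (Desc-weaken (p′ ++ x ∷ S) (ℕ.n≤1+n _) desc′)))
    where
    desc′ : Desc (suc i) (p′ ++ x ∷ S)
    desc′ = subst (Desc (suc i)) (trans (cong (_++ S) split) (++-assoc p′ [ x ] S)) d
    x-desc : Desc (suc i) (x ∷ S)
    x-desc = Desc-dropPrefix _ p′ desc′

  column-exchange : U 0 ≡ 0 → ∀ n → (word c n ++ word e n) ≈K (word l n ++ word r n)
  column-exchange U0 n =
    subst₂ _≈K_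
      (cong₂ _++_ (above-full c n) (trans (++-identityʳ _) (above-full e n)))
      (cong₂ _++_ (above-full l n) (trans (++-identityʳ _) (above-full r n)))
      (scan n 0 [] [] [] (sym U0) tt)

-- The queueing recursion

true≢false : true ≢ false
true≢false ()

stepRow : Bool → ℤ → ℤ
stepRow true  z = ℤ.suc z
stepRow false z = z

-- β t b i is the row just below the entries ≤ i of the column with top row t
-- that contains the value j + 1 iff b j.
β : ℤ → (ℕ → Bool) → ℕ → ℤ
β t b zero    = t
β t b (suc i) = stepRow (b i) (β t b i)

≤-stepRow : ∀ b z → z ℤ.≤ stepRow b z
≤-stepRow true  z = ℤ.i≤suc[i] z
≤-stepRow false z = ℤ.≤-refl

stepRow-≤ : ∀ b z → stepRow b z ℤ.≤ ℤ.suc z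
stepRow-≤ true  z = ℤ.≤-refl
stepRow-≤ false z = ℤ.i≤suc[i] z

β-cong : ∀ t {b b′} i → (∀ j → b j ≡ b′ j) → β t b i ≡ β t b′ i
β-cong t zero    h = refl
β-cong t (suc i) h = cong₂ stepRow (h i) (β-cong t i h)

β-mono : ∀ t b {i j} → i ℕ.≤ j → β t b i ℤ.≤ β t b j
β-mono t b {i} {j} p with ℕ.m≤n⇒m<n∨m≡n p
... | inj₂ refl = ℤ.≤-refl
β-mono t b {i} {suc j} p | inj₁ (s≤s q) = ℤ.≤-trans (β-mono t b q) (≤-stepRow (b j) _)

outR-true : ∀ c u → outR c true u ≡ true → c ≡ true ⊎ ∃[ v ] u ≡ suc v
outR-true true  u       _ = inj₁ refl
outR-true false (suc v) _ = inj₂ (v , refl)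

outR-false : ∀ c u → outR c true u ≡ false → c ≡ false × u ≡ 0
outR-false false zero _ = refl , refl

-- Column `M` will be the added full column, at which every search for the next cell of a slide
-- stops. `inter` is the weak increase along rows, expressed level by level for neighbouring
-- columns.
module Machine (C : ℕ → ℕ → Bool) (t : ℕ → ℤ) (M : ℕ) (full : ∀ i → C M i ≡ true)
               (inter : ∀ d i → β (t d) (C d) i ℤ.≤ β (t (suc d)) (C (suc d)) i) where

  -- After s slides column d has the values i + 1 with R s d i.  Of the s paths,
  -- U s d i are in column d at value i, and E s d i is false iff one of them
  -- enters a column ≥ d from a column < d at value i + 1.
  initialQueue : ℕ → ℕ → ℕ
  initialQueue s zero    = s
  initialQueue s (suc d) = 0

  U : ℕ → ℕ → ℕ → ℕ
  E : ℕ → ℕ → ℕ → Bool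
  U s d zero    = initialQueue s d
  U s d (suc i) = nextU (C d i) (E s d i) (U s d i)
  E s zero    i = true
  E s (suc d) i = outL (C d i) (E s d i) (U s d i)

  R : ℕ → ℕ → ℕ → Bool
  R s d i = outR (C d i) (E s d i) (U s d i)

  -- Each slide starts in the cell just above column 0, so that only this column grows at the top.
  top : ℕ → ℕ → ℤ
  top zero    d       = t d
  top (suc s) zero    = ℤ.pred (top s zero)
  top (suc s) (suc d) = t (suc d)

  top-suc : ∀ s d → top s (suc d) ≡ t (suc d)
  top-suc zero    d = refl
  top-suc (suc s) d = refl

  B : ℕ → ℕ → ℕ → ℤ
  B s d = β (top s d) (R s d)

  -- The path from tableau `s` to tableau `s + 1` never overtakes the `s` earlier ones: these are
  -- counted by `U`, and none of them is to the right of the column `p` where the new path stands.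
  Good : ℕ → ℕ → ℕ → Set
  Good s i p = (p ℕ.≤ M) × (∀ d → d ℕ.< p → U s d i ≡ 0)

  record Next (s i p p′ : ℕ) : Set where
    field
      p≤p′   : p ℕ.≤ p′
      R-p′   : R s p′ i ≡ true
      R-skip : ∀ d → p ℕ.≤ d → d ℕ.< p′ → R s d i ≡ false

  -- A `true` signal turns to `false` only at a column with a nonempty queue.
  E-true : ∀ s i p → (∀ d → d ℕ.< p → U s d i ≡ 0) → ∀ d → d ℕ.≤ p → E s d i ≡ true
  E-true s i p z zero    _ = refl
  E-true s i p z (suc d) q rewrite z d q | E-true s i p z d (ℕ.<⇒≤ q) with C d i
  ... | true  = refl
  ... | false = refl

  -- A column that receives `true` and outputs nothing neither contains the value nor has a queue,
  -- so it passes `true` on. The number `n` is the distance to column `M`.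
  search : ∀ s i d n → n ℕ.+ d ≡ M → E s d i ≡ true →
           ∃[ p′ ] Next s i d p′ × (p′ ℕ.≤ M) × (∀ d′ → d ℕ.≤ d′ → d′ ℕ.≤ p′ → E s d′ i ≡ true)
  search s i d n eq e with R s d i in r
  ... | true = d , record { p≤p′ = ℕ.≤-refl ; R-p′ = r
                          ; R-skip = λ d′ p q → ⊥-elim (ℕ.<-irrefl refl (ℕ.≤-<-trans p q)) }
                 , subst (d ℕ.≤_) eq (ℕ.m≤n+m d n)
                 , λ d′ p q → subst (λ d → E s d i ≡ true) (ℕ.≤-antisym p q) e
  -- Here `d` is `M`, and a full column outputs the value whenever its incoming signal is `true`.
  search s i d zero refl e | false with () ← trans (sym r) (trans (cong₂ (λ c x → outR c x (U s d i)) (full i) e) refl)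
  search s i d (suc n) eq e | false
    with c0 , u0 ← outR-false (C d i) (U s d i) (trans (cong (λ x → outR (C d i) x (U s d i)) (sym e)) r)
    with p′ , nx , p′≤ , es ← search s i (suc d) n (trans (ℕ.+-suc n d) eq)
                          (trans (cong₂ (λ c x → outL c x (U s d i)) c0 e) (cong (outL false true) u0)) =
    p′ , record { p≤p′ = ℕ.<⇒≤ (Next.p≤p′ nx) ; R-p′ = Next.R-p′ nx ; R-skip = skip } , p′≤ , es′
    where
    skip : ∀ d′ → d ℕ.≤ d′ → d′ ℕ.< p′ → R s d′ i ≡ false
    skip d′ p q with ℕ.m≤n⇒m<n∨m≡n p
    ... | inj₁ p< = Next.R-skip nx d′ p< q
    ... | inj₂ refl = r
    es′ : ∀ d′ → d ℕ.≤ d′ → d′ ℕ.≤ p′ → E s d′ i ≡ true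
    es′ d′ p q with ℕ.m≤n⇒m<n∨m≡n p
    ... | inj₁ p< = es d′ p< q
    ... | inj₂ refl = e

  record Step (s i p p′ : ℕ) : Set where
    field
      next : Next s i p p′
      good : Good s (suc i) p′
      E-before : ∀ d → d ℕ.≤ p′ → E s d i ≡ true
    open Next next public

  abstract
    -- Columns to the right of `p` receive `true` with an empty queue, and skipped columns have
    -- neither the value nor a queue. Hence all queues to the right of `p′` are empty at the next
    -- value.
    advance : ∀ s i p → Good s i p → ∃[ p′ ] Step s i p p′
    advance s i p (p≤M , z)
      with p′ , nx , p′≤M , es ← search s i p (M ℕ.∸ p) (ℕ.m∸n+n≡m p≤M) (E-true s i p z p ℕ.≤-refl) =
      p′ , record { next = nx ; good = p′≤M , z′ ; E-before = E-before }
      where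
      E-before : ∀ d → d ℕ.≤ p′ → E s d i ≡ true
      E-before d q with ℕ.≤-total d p
      ... | inj₁ d≤p = E-true s i p z d d≤p
      ... | inj₂ p≤d = es d p≤d q
      z′ : ∀ d → d ℕ.< p′ → U s d (suc i) ≡ 0
      z′ d q with d ℕ.<? p
      ... | yes d<p rewrite z d d<p | E-before d (ℕ.<⇒≤ q) with C d i
      ...   | true  = refl
      ...   | false = refl
      z′ d q | no d≮p with r ← Next.R-skip nx d (ℕ.≮⇒≥ d≮p) q
        rewrite E-before d (ℕ.<⇒≤ q) with c0 , u0 ← outR-false (C d i) (U s d i) r
        rewrite c0 | u0 = refl

  path : ∀ s i → Σ ℕ (Good s i)
  path s zero    = 0 , z≤n , λ d ()
  path s (suc i) = let p′ , st = advance s i (proj₁ (path s i)) (proj₂ (path s i)) in p′ , Step.good st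

  pos : ℕ → ℕ → ℕ
  pos s i = proj₁ (path s i)

  step : ∀ s i → Step s i (pos s i) (pos s (suc i))
  step s i = proj₂ (advance s i (proj₁ (path s i)) (proj₂ (path s i)))

  U-before : ∀ s i d → d ℕ.< pos s i → U s d i ≡ 0
  U-before s i = proj₂ (proj₂ (path s i))

  pos≤M : ∀ s i → pos s i ℕ.≤ M
  pos≤M s i = proj₁ (proj₂ (path s i))

  -- The effect of one additional customer: the queue where it stands is longer by one, and there
  -- the entries up to `i` end one row higher. That this persists from level to level identifies its
  -- trajectory with the slide path.
  record Sim (s i p : ℕ) : Set where
    field
      U-on  : ∀ d → d ≡ p → U (suc s) d i ≡ suc (U s d i)
      U-off : ∀ d → d ≢ p → U (suc s) d i ≡ U s d i
      B-on  : ∀ d → d ≡ p → B s d i ≡ ℤ.suc (B (suc s) d i)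
      B-off : ∀ d → d ≢ p → B (suc s) d i ≡ B s d i

  -- The outputs of column d in slides s and s + 1 at level i, where the
  -- path of slide s moves from column p to column p′.
  data Local (s i p p′ d : ℕ) : Set where
    away  : d ≢ p → d ≢ p′ → R (suc s) d i ≡ R s d i → U (suc s) d (suc i) ≡ U s d (suc i) → Local s i p p′ d
    stay  : d ≡ p → d ≡ p′ → R s d i ≡ true → R (suc s) d i ≡ true →
            U (suc s) d (suc i) ≡ suc (U s d (suc i)) → Local s i p p′ d
    leave : d ≡ p → d ≢ p′ → R s d i ≡ false → R (suc s) d i ≡ true →
            U (suc s) d (suc i) ≡ U s d (suc i) → Local s i p p′ d
    land  : d ≢ p → d ≡ p′ → R s d i ≡ true → R (suc s) d i ≡ false →
            U (suc s) d (suc i) ≡ suc (U s d (suc i)) → Local s i p p′ d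

  module Level (s i p p′ : ℕ) (idle-before : ∀ d → d ℕ.< p → U s d i ≡ 0)
               (st : Step s i p p′) (sm : Sim s i p) where
    open Sim sm
    open Step st

    E′-before : ∀ d → d ℕ.≤ p → E (suc s) d i ≡ true
    E′-before = E-true (suc s) i p λ d q →
      trans (U-off d (ℕ.<⇒≢ q)) (idle-before d q)

    idle : ∀ d → p ℕ.≤ d → d ℕ.< p′ → C d i ≡ false × U s d i ≡ 0
    idle d q q′ = outR-false (C d i) (U s d i)
      (trans (cong (λ x → outR (C d i) x (U s d i)) (sym (E-before d (ℕ.<⇒≤ q′)))) (R-skip d q q′))

    -- In run `s` the columns from `p` up to `p′` are idle. The extra customer is therefore served
    -- at `p` and runs through all of them, which makes the signal `false` until `p′`.
    E′-between : ∀ d → p ℕ.< d → d ℕ.≤ p′ → E (suc s) d i ≡ false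
    E′-between (suc d) (s≤s q) q′ with ℕ.m≤n⇒m<n∨m≡n q | idle d q q′
    ... | inj₂ refl | c0 , u0 rewrite c0 | E′-before d ℕ.≤-refl | U-on d refl = refl
    ... | inj₁ p<d  | c0 , u0 rewrite c0 | E′-between d p<d (ℕ.<⇒≤ q′) = refl

    -- Column `p′` outputs the value in run `s`, so it contains the value or has a queue. In both
    -- cases one more customer, arriving or already waiting, leaves the outgoing signal unchanged.
    E′-after : ∀ d → p′ ℕ.< d → E (suc s) d i ≡ E s d i
    E′-after (suc d) (s≤s q) with ℕ.m≤n⇒m<n∨m≡n q
    ... | inj₁ p′<d rewrite E′-after d p′<d
                          | U-off d (λ eq → ℕ.<-irrefl (sym eq) (ℕ.≤-<-trans p≤p′ p′<d)) = refl
    ... | inj₂ refl with ℕ.m≤n⇒m<n∨m≡n p≤p′ | R-p′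
    ...   | inj₁ p<p′ | r rewrite E-before d ℕ.≤-refl | E′-between d p<p′ ℕ.≤-refl
            with outR-true (C d i) (U s d i) r
    ...     | inj₁ c1 rewrite c1 = refl
    ...     | inj₂ (v , u1) rewrite u1 with C d i
    ...       | true  = refl
    ...       | false = refl
    E′-after (suc d) (s≤s q) | inj₂ refl | inj₂ p≡p′ | r
      rewrite E-before d ℕ.≤-refl | E′-before d (ℕ.≤-reflexive (sym p≡p′)) | U-on d (sym p≡p′)
      with outR-true (C d i) (U s d i) r
    ... | inj₁ c1 rewrite c1 = refl
    ... | inj₂ (v , u1) rewrite u1 with C d i
    ...   | true  = refl
    ...   | false = refl

    same : ∀ d → d ≢ p → E (suc s) d i ≡ E s d i → R (suc s) d i ≡ R s d i × U (suc s) d (suc i) ≡ U s d (suc i)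
    same d d≢p e rewrite e | U-off d d≢p = refl , refl

    local : ∀ d → Local s i p p′ d
    local d with ℕ.<-cmp d p
    ... | tri< d<p d≢p _ = away d≢p (ℕ.<⇒≢ (ℕ.<-≤-trans d<p p≤p′)) (proj₁ eqs) (proj₂ eqs)
      where eqs = same d d≢p (trans (E′-before d (ℕ.<⇒≤ d<p)) (sym (E-before d (ℕ.<⇒≤ (ℕ.<-≤-trans d<p p≤p′)))))
    local d | tri≈ _ refl _ with ℕ.m≤n⇒m<n∨m≡n p≤p′
    ... | inj₁ p<p′ = leave refl (ℕ.<⇒≢ p<p′) (R-skip d ℕ.≤-refl p<p′) (proj₁ eqs) (proj₂ eqs)
      where
      eqs : R (suc s) d i ≡ true × U (suc s) d (suc i) ≡ U s d (suc i)
      eqs with idle d ℕ.≤-refl p<p′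
      ... | c0 , u0 rewrite c0 | U-on d refl | u0 | E′-before d ℕ.≤-refl | E-before d p≤p′ = refl , refl
    ... | inj₂ p≡p′ = stay refl p≡p′ r1 (proj₁ eqs) (proj₂ eqs)
      where
      r1 : R s d i ≡ true
      r1 = subst (λ q → R s q i ≡ true) (sym p≡p′) R-p′
      eqs : R (suc s) d i ≡ true × U (suc s) d (suc i) ≡ suc (U s d (suc i))
      eqs with r ← r1 rewrite U-on d refl | E′-before d ℕ.≤-refl | E-before d p≤p′
        with C d i | outR-true (C d i) (U s d i) r
      ... | true  | _ = refl , refl
      ... | false | inj₂ (v , u1) rewrite u1 = refl , refl
    local d | tri> _ d≢p p<d with ℕ.<-cmp d p′
    ... | tri< d<p′ d≢p′ _ = away d≢p d≢p′ (proj₁ eqs) (proj₂ eqs)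
      where
      eqs : R (suc s) d i ≡ R s d i × U (suc s) d (suc i) ≡ U s d (suc i)
      eqs with idle d (ℕ.<⇒≤ p<d) d<p′
      ... | c0 , u0 rewrite c0 | U-off d d≢p | u0 | E′-between d p<d (ℕ.<⇒≤ d<p′) | E-before d (ℕ.<⇒≤ d<p′) = refl , refl
    ... | tri> _ d≢p′ p′<d = away d≢p d≢p′ (proj₁ eqs) (proj₂ eqs)
      where eqs = same d d≢p (E′-after d p′<d)
    ... | tri≈ _ refl _ = land d≢p refl R-p′ (proj₁ eqs) (proj₂ eqs)
      where
      eqs : R (suc s) d i ≡ false × U (suc s) d (suc i) ≡ suc (U s d (suc i))
      eqs with r ← R-p′ rewrite U-off d d≢p | E′-between d p<d ℕ.≤-refl | E-before d ℕ.≤-refl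
        with C d i | outR-true (C d i) (U s d i) r
      ... | true  | _ = refl , refl
      ... | false | inj₂ (v , u1) rewrite u1 = refl , refl

    sim-suc : Sim s (suc i) p′
    Sim.U-on sim-suc d eq with local d
    ... | away _ n _ _ = ⊥-elim (n eq)
    ... | stay _ _ _ _ u = u
    ... | leave _ n _ _ _ = ⊥-elim (n eq)
    ... | land _ _ _ _ u = u
    Sim.U-off sim-suc d n with local d
    ... | away _ _ _ u = u
    ... | stay _ eq _ _ _ = ⊥-elim (n eq)
    ... | leave _ _ _ _ u = u
    ... | land _ eq _ _ _ = ⊥-elim (n eq)
    Sim.B-on sim-suc d eq with local d
    ... | away _ n _ _ = ⊥-elim (n eq)
    ... | leave _ n _ _ _ = ⊥-elim (n eq)
    ... | stay on _ r r′ _ = trans (cong (λ x → stepRow x (B s d i)) r)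
            (trans (cong ℤ.suc (B-on d on)) (cong (λ x → ℤ.suc (stepRow x (B (suc s) d i))) (sym r′)))
    ... | land off _ r r′ _ = trans (cong (λ x → stepRow x (B s d i)) r)
            (trans (cong ℤ.suc (sym (B-off d off))) (cong (λ x → ℤ.suc (stepRow x (B (suc s) d i))) (sym r′)))
    Sim.B-off sim-suc d n with local d
    ... | away off _ r _ = cong₂ stepRow r (B-off d off)
    ... | stay _ eq _ _ _ = ⊥-elim (n eq)
    ... | land _ eq _ _ _ = ⊥-elim (n eq)
    ... | leave on _ r r′ _ = trans (cong (λ x → stepRow x (B (suc s) d i)) r′)
            (trans (sym (B-on d on)) (cong (λ x → stepRow x (B s d i)) (sym r)))

  sim : ∀ s i → Sim s i (pos s i)
  sim s zero = record { U-on = λ { _ refl → refl } ; U-off = uoff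
                      ; B-on = λ { _ refl → sym (ℤ.suc-pred _) } ; B-off = boff }
    where
    uoff : ∀ d → d ≢ 0 → U (suc s) d 0 ≡ U s d 0
    uoff zero    n = ⊥-elim (n refl)
    uoff (suc d) n = refl
    boff : ∀ d → d ≢ 0 → top (suc s) d ≡ top s d
    boff zero    n = ⊥-elim (n refl)
    boff (suc d) n = sym (top-suc s d)
  sim s (suc i) =
    Level.sim-suc s i (pos s i) (pos s (suc i)) (U-before s i) (step s i) (sim s i)

  local : ∀ s i d → Local s i (pos s i) (pos s (suc i)) d
  local s i = Level.local s i (pos s i) (pos s (suc i)) (U-before s i) (step s i) (sim s i)

  E-zero : ∀ d i → E 0 d i ≡ true
  U-zero : ∀ d i → U 0 d i ≡ 0
  E-zero zero    i = refl
  E-zero (suc d) i rewrite E-zero d i | U-zero d i with C d i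
  ... | true  = refl
  ... | false = refl
  U-zero zero    zero    = refl
  U-zero (suc d) zero    = refl
  U-zero d (suc i) rewrite E-zero d i | U-zero d i with C d i
  ... | true  = refl
  ... | false = refl

  R-zero : ∀ d i → R 0 d i ≡ C d i
  R-zero d i rewrite E-zero d i | U-zero d i with C d i
  ... | true  = refl
  ... | false = refl

  B-zero : ∀ d i → B 0 d i ≡ β (t d) (C d) i
  B-zero d i = β-cong (t d) i (R-zero d)

  -- Induction on the slides. A slide raises the boundary only in the column of its path, so the
  -- inequality is in danger only if this is the left one of the two columns; there `gap` has a row
  -- to spare.
  interlace : ∀ s d i → B s d i ℤ.≤ B s (suc d) i
  -- If the path stays in the left column, that column contains the value and its boundary moves at
  -- least as far as that of its right neighbour. If the path has just arrived, the neighbour was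
  -- skipped and lacks the value, which makes the weak inequality strict.
  gap : ∀ s d i → suc d ≡ pos s i → ℤ.suc (B s d i) ℤ.≤ B s (suc d) i

  interlace zero    d i = subst₂ ℤ._≤_ (sym (B-zero d i)) (sym (B-zero (suc d) i)) (inter d i)
  interlace (suc s) d i with suc d ℕ.≟ pos s i
  ... | yes eq = subst₂ ℤ._≤_ (trans (ℤ.pred-suc _) (sym (B-off d λ eq′ → ℕ.<-irrefl (trans eq′ (sym eq)) ℕ.≤-refl)))
                        (trans (cong ℤ.pred (B-on (suc d) eq)) (ℤ.pred-suc _))
                        (ℤ.pred-mono (gap s d i eq))
    where open Sim (sim s i)
  ... | no neq = ℤ.≤-trans lower (subst (B s d i ℤ.≤_) (sym (B-off (suc d) neq)) (interlace s d i))
    where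
    open Sim (sim s i)
    lower : B (suc s) d i ℤ.≤ B s d i
    lower with d ℕ.≟ pos s i
    ... | yes eq = subst (B (suc s) d i ℤ.≤_) (sym (B-on d eq)) (ℤ.i≤suc[i] _)
    ... | no n   = ℤ.≤-reflexive (B-off d n)

  gap s d zero ()
  gap s d (suc i) eq with ℕ.m≤n⇒m<n∨m≡n (subst (pos s i ℕ.≤_) (sym eq) p≤p′)
    where open Step (step s i)
  ... | inj₂ stays = ℤ.≤-trans (ℤ.suc-mono (ℤ.≤-trans (stepRow-≤ (R s d i) _) (gap s d i (sym stays))))
                      (ℤ.≤-reflexive (cong (λ x → stepRow x (B s (suc d) i)) (sym (subst (λ q → R s q i ≡ true) (sym eq) R-p′))))
    where open Step (step s i)
  ... | inj₁ (s≤s p≤d) = subst₂ (λ x y → ℤ.suc (stepRow x (B s d i)) ℤ.≤ stepRow y (B s (suc d) i))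
                     (sym (R-skip d p≤d (subst (d ℕ.<_) eq ℕ.≤-refl)))
                     (sym (subst (λ q → R s q i ≡ true) (sym eq) R-p′))
                     (ℤ.suc-mono (interlace s d i))
    where open Step (step s i)

  interlace-≤ : ∀ s i {d d′} → d ℕ.≤ d′ → B s d i ℤ.≤ B s d′ i
  interlace-≤ s i {d} {d′} q with ℕ.m≤n⇒m<n∨m≡n q
  ... | inj₂ refl = ℤ.≤-refl
  interlace-≤ s i {d} {suc d′} q | inj₁ (s≤s q′) = ℤ.≤-trans (interlace-≤ s i q′) (interlace s d′ i)

  -- The number of slides that fill the rightmost column.

  missing : ℕ → ℕ
  missing zero    = 0
  missing (suc i) with C 0 i
  ... | true  = missing i
  ... | false = suc (missing i)

  missing≤ : ∀ i → missing i ℕ.≤ i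
  missing≤ zero = z≤n
  missing≤ (suc i) with C 0 i
  ... | true  = ℕ.m≤n⇒m≤1+n (missing≤ i)
  ... | false = s≤s (missing≤ i)

  missing-suc : ∀ i → missing i ℕ.≤ missing (suc i)
  missing-suc i with C 0 i
  ... | true  = ℕ.≤-refl
  ... | false = ℕ.n≤1+n _

  -- Nobody enters column 0 from the right, and it serves one customer at each value it lacks. The
  -- hypothesis keeps the truncated `pred` away from an empty queue.
  U+missing : ∀ s i → missing i ℕ.≤ s → U s 0 i ℕ.+ missing i ≡ s
  U+missing s zero    _ = ℕ.+-identityʳ s
  U+missing s (suc i) m≤s with ih ← U+missing s i (ℕ.≤-trans (missing-suc i) m≤s) with C 0 i
  ... | true = ih
  ... | false with U s 0 i
  ...   | zero  = ⊥-elim (ℕ.<-irrefl (sym (trans (sym ih) refl)) m≤s)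
  ...   | suc u = trans (ℕ.+-suc u _) ih

  queue-nonempty : ∀ s i → missing (suc i) ℕ.≤ s → C 0 i ≡ false → ∃[ v ] U s 0 i ≡ suc v
  queue-nonempty s i m≤s c0 with ih ← U+missing s i (ℕ.≤-trans (missing-suc i) m≤s) rewrite c0
    with U s 0 i
  ... | zero  = ⊥-elim (ℕ.<-irrefl ih m≤s)
  ... | suc u = u , refl

  filled⇒missing≤ : ∀ s k → (∀ i → i ℕ.< k → R s 0 i ≡ true) → missing k ℕ.≤ s
  filled⇒missing≤ s zero    _ = z≤n
  filled⇒missing≤ s (suc k) h with ih ← filled⇒missing≤ s k (λ i q → h i (ℕ.m<n⇒m<1+n q)) | r ← h k ℕ.≤-refl
    with eq ← U+missing s k ih with C 0 k
  ... | true = ih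
  ... | false with U s 0 k
  ...   | suc u = subst (suc (missing k) ℕ.≤_) eq (s≤s (ℕ.m≤n+m _ u))

  missing-mono : ∀ {i j} → i ℕ.≤ j → missing i ℕ.≤ missing j
  missing-mono {i} {j} q with ℕ.m≤n⇒m<n∨m≡n q
  ... | inj₂ refl = ℕ.≤-refl
  missing-mono {i} {suc j} q | inj₁ (s≤s q′) = ℕ.≤-trans (missing-mono q′) (missing-suc j)

  filled : ∀ s k → missing k ℕ.≤ s → ∀ i → i ℕ.< k → R s 0 i ≡ true
  filled s k m≤s i i<k with C 0 i | queue-nonempty s i (ℕ.≤-trans (missing-mono i<k) m≤s)
  ... | true  | _ = refl
  ... | false | q with v , u1 ← q refl rewrite u1 = refl

  -- With enough customers column 0 sends one on at every value it lacks, so the signal to column 1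
  -- is the original column 0. This is the column that the Knuth exchanges carry to the left.
  E-one : ∀ s k → missing k ℕ.≤ s → ∀ i → i ℕ.< k → E s 1 i ≡ C 0 i
  E-one s k m≤s i i<k with C 0 i | queue-nonempty s i (ℕ.≤-trans (missing-mono i<k) m≤s)
  ... | true  | _ = refl
  ... | false | q with v , u1 ← q refl rewrite u1 = refl

  C⇒R₀ : ∀ s i → C 0 i ≡ true → R s 0 i ≡ true
  C⇒R₀ s i c rewrite c = refl

  C⇒E : ∀ s d i → C d i ≡ true → E s (suc d) i ≡ true
  C⇒E s d i c rewrite c = refl

  R-M : ∀ s i → R s M i ≡ E s M i
  R-M s i rewrite full i = refl

  -- Outside column 0 a queue starts empty and grows only at values that the column contains. This
  -- is why empty columns stay empty.
  queue⇒entry : ∀ s d i v → U s (suc d) i ≡ suc v → ∃[ y ] (y ℕ.< i) × C (suc d) y ≡ true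
  queue⇒entry s d (suc i) v eq with C (suc d) i in c
  ... | true = i , ℕ.≤-refl , c
  ... | false with E s (suc d) i | U s (suc d) i in equ
  ...   | true  | suc u = let y , q , cy = queue⇒entry s d i u equ in y , ℕ.m<n⇒m<1+n q , cy
  ...   | false | suc u = let y , q , cy = queue⇒entry s d i u equ in y , ℕ.m<n⇒m<1+n q , cy

  R⇒entry : ∀ s d i → R s (suc d) i ≡ true → ∃[ y ] (y ℕ.≤ i) × C (suc d) y ≡ true
  R⇒entry s d i r with C (suc d) i in c
  ... | true = i , ℕ.≤-refl , c
  ... | false with E s (suc d) i | U s (suc d) i in equ
  ...   | true | suc u = let y , q , cy = queue⇒entry s d i u equ in y , ℕ.<⇒≤ q , cy

-- Fillings given by columns

minus-one : ∀ z → z ℤ.- + 1 ≡ ℤ.pred z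
minus-one z = ℤ.+-comm z _

plus-one : ∀ z → z ℤ.+ + 1 ≡ ℤ.suc z
plus-one z = ℤ.+-comm z _

suc-offset : ∀ z n → ℤ.suc (z ℤ.+ + n) ≡ z ℤ.+ + suc n
suc-offset z n = lemma z (+ n)
  where
  lemma : ∀ z i → + 1 ℤ.+ (z ℤ.+ i) ≡ z ℤ.+ (+ 1 ℤ.+ i)
  lemma = solve-∀

pred-< : ∀ z → ℤ.pred z ℤ.< z
pred-< z = ℤ.i≤pred[j]⇒i<j ℤ.≤-refl

minus-cancel : ∀ c {d d′} → c ℤ.- + d ≡ c ℤ.- + d′ → d ≡ d′
minus-cancel c eq = ℤ.+-injective (ℤ.neg-injective (+-cancelˡ c _ _ eq))

maybe-ext : {m n : Maybe ℕ} → (∀ a → m ≡ just a → n ≡ just a) → (∀ a → n ≡ just a → m ≡ just a) → m ≡ n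
maybe-ext {just a}  {n}       f g = sym (f a refl)
maybe-ext {nothing} {just b}  f g = g b refl
maybe-ext {nothing} {nothing} f g = refl

is-nothing : {m : Maybe ℕ} → (∀ a → m ≢ just a) → m ≡ nothing
is-nothing {just a}  f = ⊥-elim (f a refl)
is-nothing {nothing} f = refl

β-strict : ∀ t b {x y} → b x ≡ true → x ℕ.< y → β t b x ℤ.< β t b y
β-strict t b {x} {y} bx x<y = ℤ.suc[i]≤j⇒i<j
  (subst (λ v → stepRow v (β t b x) ℤ.≤ β t b y) bx (β-mono t b x<y))

β-injective : ∀ t b {x y} → b x ≡ true → b y ≡ true → β t b x ≡ β t b y → x ≡ y
β-injective t b {x} {y} bx by eq with ℕ.<-cmp x y
... | tri< x<y _ _ = ⊥-elim (ℤ.<-irrefl eq (β-strict t b bx x<y))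
... | tri≈ _ x≡y _ = x≡y
... | tri> _ _ y<x = ⊥-elim (ℤ.<-irrefl (sym eq) (β-strict t b by y<x))

β-first : ∀ t b x → b x ≡ true → ∃[ y ] (y ℕ.≤ x) × (b y ≡ true) × (β t b y ≡ t)
β-first t b x bx with search x
  where
  search : ∀ x → (∃[ y ] (y ℕ.< x) × (b y ≡ true) × (β t b y ≡ t)) ⊎ β t b x ≡ t
  search zero = inj₂ refl
  search (suc x) with search x
  ... | inj₁ (y , q , by , eq) = inj₁ (y , ℕ.m<n⇒m<1+n q , by , eq)
  ... | inj₂ eq with b x in bx
  ...   | true  = inj₁ (x , ℕ.≤-refl , bx , eq)
  ...   | false = inj₂ eq
... | inj₁ (y , q , by , eq) = y , ℕ.<⇒≤ q , by , eq
... | inj₂ eq = x , ℕ.≤-refl , bx , eq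

HasEntry : ℕ → ℤ → ℕ → (ℕ → ℤ) → (ℕ → ℕ → Bool) → ℤ → ℤ → ℕ → Set
HasEntry k cₘ m t b r c a = ∃[ d ] ∃[ x ]
  (d ℕ.≤ m) × (x ℕ.< k) × (c ≡ cₘ ℤ.- + d) × (b d x ≡ true) × (r ≡ β (t d) (b d) x) × (a ≡ suc x)

-- F has the columns cₘ - m, …, cₘ, where column cₘ - d has top row t d and
-- consists of the values x + 1 ≤ k with b d x.
record Rep (k : ℕ) (cₘ : ℤ) (m : ℕ) (t : ℕ → ℤ) (b : ℕ → ℕ → Bool) (F : Filling) : Set where
  field
    sound    : ∀ r c a → F (r , c) ≡ just a → HasEntry k cₘ m t b r c a
    complete : ∀ r c a → HasEntry k cₘ m t b r c a → F (r , c) ≡ just a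

  at : ∀ {d x} → d ℕ.≤ m → x ℕ.< k → b d x ≡ true → F (β (t d) (b d) x , cₘ ℤ.- + d) ≡ just (suc x)
  at d≤m x<k bx = complete _ _ _ (_ , _ , d≤m , x<k , refl , bx , refl , refl)

  sound-at : ∀ d r a → F (r , cₘ ℤ.- + d) ≡ just a →
             ∃[ x ] (d ℕ.≤ m) × (x ℕ.< k) × (b d x ≡ true) × (r ≡ β (t d) (b d) x) × (a ≡ suc x)
  sound-at d r a eq with d′ , x , d≤m , x<k , ceq , bx , req , aeq ← sound r _ a eq
    with refl ← minus-cancel cₘ ceq = x , d≤m , x<k , bx , req , aeq

searchColumn : ℤ → (ℕ → Bool) → ℤ → ℕ → Maybe ℕ
searchColumn t b r zero    = nothing
searchColumn t b r (suc x) with b x | β t b x ℤ.≟ r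
... | true  | yes _ = just (suc x)
... | true  | no  _ = searchColumn t b r x
... | false | _     = searchColumn t b r x

searchColumn-sound : ∀ t b r k a → searchColumn t b r k ≡ just a →
                     ∃[ x ] (x ℕ.< k) × (b x ≡ true) × (r ≡ β t b x) × (a ≡ suc x)
searchColumn-sound t b r (suc k) a eq with b k in bk | β t b k ℤ.≟ r
... | true  | yes q = k , ℕ.≤-refl , bk , sym q , sym (just-injective eq)
... | true  | no  _ = let x , x<k , rest = searchColumn-sound t b r k a eq in x , ℕ.m<n⇒m<1+n x<k , rest
... | false | _     = let x , x<k , rest = searchColumn-sound t b r k a eq in x , ℕ.m<n⇒m<1+n x<k , rest

searchColumn-complete : ∀ t b r k x → x ℕ.< k → b x ≡ true → r ≡ β t b x → searchColumn t b r k ≡ just (suc x)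
searchColumn-complete t b r (suc k) x x<k bx req with b k in bk | β t b k ℤ.≟ r
... | true  | yes q = cong (λ y → just (suc y)) (β-injective t b bk bx (trans q req))
... | true  | no ¬q = searchColumn-complete t b r k x
  (ℕ.≤∧≢⇒< (ℕ.s≤s⁻¹ x<k) λ { refl → ¬q (sym req) }) bx req
... | false | _ = searchColumn-complete t b r k x
  (ℕ.≤∧≢⇒< (ℕ.s≤s⁻¹ x<k) λ { refl → true≢false (trans (sym bx) bk) }) bx req

fill : ℕ → ℤ → ℕ → (ℕ → ℤ) → (ℕ → ℕ → Bool) → Filling
fill k cₘ m t b (r , c) with cₘ ℤ.- c
... | ℤ.-[1+ _ ] = nothing
... | + d with d ℕ.≤? m
...   | yes _ = searchColumn (t d) (b d) r k
...   | no  _ = nothing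

minus-flip : ∀ c d z → c ℤ.- d ≡ z → d ≡ c ℤ.- z
minus-flip c d z eq = trans (lemma c d) (cong (λ y → c ℤ.- y) eq)
  where
  lemma : ∀ c d → d ≡ c ℤ.- (c ℤ.- d)
  lemma = solve-∀

fill-rep : ∀ k cₘ m t b → Rep k cₘ m t b (fill k cₘ m t b)
Rep.sound (fill-rep k cₘ m t b) r c a eq with cₘ ℤ.- c in ceq
... | + d with d ℕ.≤? m
...   | yes d≤m with x , x<k , bx , req , aeq ← searchColumn-sound (t d) (b d) r k a eq =
  d , x , d≤m , x<k , minus-flip cₘ c (+ d) ceq , bx , req , aeq
Rep.complete (fill-rep k cₘ m t b) r c a (d , x , d≤m , x<k , ceq , bx , req , aeq)
  with cₘ ℤ.- c | sym (minus-flip cₘ (+ d) c (sym ceq))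
... | .(+ d) | refl with d ℕ.≤? m
...   | yes _ = trans (searchColumn-complete (t d) (b d) r k x x<k bx req) (cong just (sym aeq))
...   | no ¬q = ⊥-elim (¬q d≤m)

minus-antimono : ∀ c {d d′} → d ℕ.≤ d′ → c ℤ.- + d′ ℤ.≤ c ℤ.- + d
minus-antimono c q = ℤ.+-monoʳ-≤ c (ℤ.neg-mono-≤ (ℤ.+≤+ q))

minus-cancel-≤ : ∀ c {d d′} → c ℤ.- + d′ ℤ.≤ c ℤ.- + d → d ℕ.≤ d′
minus-cancel-≤ c {d} {d′} q with d ℕ.≤? d′
... | yes p = p
... | no ¬p = ⊥-elim (ℕ.<-irrefl (minus-cancel c (ℤ.≤-antisym q (minus-antimono c (ℕ.<⇒≤ (ℕ.≰⇒> ¬p))))) (ℕ.≰⇒> ¬p) )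

-- Column slides

minus-zero : ∀ c → c ℤ.- + 0 ≡ c
minus-zero = ℤ.+-identityʳ

β-all : ∀ z b i → (∀ j → j ℕ.< i → b j ≡ true) → β z b i ≡ z ℤ.+ + i
β-all z b zero    h = sym (ℤ.+-identityʳ z)
β-all z b (suc i) h = trans (cong₂ stepRow (h i ℕ.≤-refl) (β-all z b i (λ j q → h j (ℕ.m<n⇒m<1+n q))))
                            (suc-offset z i)

module Slides (k : ℕ) (cₘ : ℤ) (C : ℕ → ℕ → Bool) (t : ℕ → ℤ) (M : ℕ) (full : ∀ i → C M i ≡ true)
              (inter : ∀ d i → β (t d) (C d) i ℤ.≤ β (t (suc d)) (C (suc d)) i)
              (nonempty : ∃[ x ] (x ℕ.< k) × (C 0 x ≡ true)) where
  open Machine C t M full inter public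

  T : ℕ → Filling
  T s = fill k cₘ M (top s) (R s)

  T-rep : ∀ s → Rep k cₘ M (top s) (R s) (T s)
  T-rep s = fill-rep k cₘ M (top s) (R s)

  -- The row just above the boundary: for positive `i` it holds the entry `i` before the slide, and
  -- for `i = 0` it is the starting box above column 0.
  cell : ℕ → ℕ → Cell
  cell s i = ℤ.pred (B s (pos s i) i) , cₘ ℤ.- + pos s i

  cell-suc : ∀ s i → cell s (suc i) ≡ (B s (pos s (suc i)) i , cₘ ℤ.- + pos s (suc i))
  cell-suc s i = cong (_, cₘ ℤ.- + pos s (suc i))
    (trans (cong (λ x → ℤ.pred (stepRow x (B s (pos s (suc i)) i))) R-p′) (ℤ.pred-suc _))
    where open Step (step s i)

  -- The path moves to the nearest column, weakly to the left, that contains `suc i`. By interlacing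
  -- the boundaries descend to the left, so the cell found is below the empty box and weakly above
  -- every other candidate.
  firstGreater : ∀ s i → i ℕ.< k → FirstGreater (T s) (suc i) (cell s i) (cell s (suc i))
  firstGreater s i i<k = subst (FirstGreater (T s) (suc i) (cell s i)) (sym (cell-suc s i)) (
    Rep.at (T-rep s) (pos≤M s (suc i)) i<k R-p′ ,
    (minus-antimono cₘ p≤p′ , ℤ.<-≤-trans (pred-< _) (interlace-≤ s i p≤p′)) ,
    first)
    where
    open Step (step s i)
    first : ∀ e → T s e ≡ just (suc i) → cell s i ≺ e → (B s (pos s (suc i)) i , cₘ ℤ.- + pos s (suc i)) ≼ e
    first (r , c) eq (c≤ , _) with d , x , d≤M , x<k , refl , rx , refl , refl ← Rep.sound (T-rep s) r c _ eq =
      minus-antimono cₘ p′≤d , interlace-≤ s i p′≤d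
      where
      p′≤d : pos s (suc i) ℕ.≤ d
      p′≤d = ℕ.≮⇒≥ λ d<p′ → true≢false (trans (sym rx) (R-skip d (minus-cancel-≤ cₘ c≤) d<p′))

  R′-pos : ∀ s i → R (suc s) (pos s i) i ≡ true
  R′-pos s i with local s i (pos s i)
  ... | away n _ _ _ = ⊥-elim (n refl)
  ... | stay _ _ _ r _ = r
  ... | leave _ _ _ r _ = r
  ... | land n _ _ _ _ = ⊥-elim (n refl)

  -- On the path the boundary rises by one row, so the same cell is the boundary in tableau `s + 1`:
  -- the place of the entry `suc i` if `i < k`, and the first free cell below the column if `i = k`.
  cell-B′ : ∀ s i → cell s i ≡ (B (suc s) (pos s i) i , cₘ ℤ.- + pos s i)
  cell-B′ s i = cong (_, cₘ ℤ.- + pos s i) (trans (cong ℤ.pred (Sim.B-on (sim s i) (pos s i) refl)) (ℤ.pred-suc _))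

  T′-cell : ∀ s i → i ℕ.< k → T (suc s) (cell s i) ≡ just (suc i)
  T′-cell s i i<k = trans (cong (T (suc s)) (cell-B′ s i)) (Rep.at (T-rep (suc s)) (pos≤M s i) i<k (R′-pos s i))

  T′-end : ∀ s → T (suc s) (cell s k) ≡ nothing
  T′-end s = trans (cong (T (suc s)) (cell-B′ s k)) (is-nothing λ a eq →
    let x , _ , x<k , rx , req , _ = Rep.sound-at (T-rep (suc s)) (pos s k) _ a eq
    in ℤ.<-irrefl (sym req) (β-strict (top (suc s) (pos s k)) (R (suc s) (pos s k)) rx x<k))

  off-path : ∀ s e → (∀ i → i ℕ.≤ k → e ≢ cell s i) → T (suc s) e ≡ T s e
  off-path s (r , c) off = maybe-ext new⇒old old⇒new
    where
    old⇒new : ∀ a → T s (r , c) ≡ just a → T (suc s) (r , c) ≡ just a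
    old⇒new a eq with d , x , d≤M , x<k , refl , rx , refl , refl ← Rep.sound (T-rep s) r c _ eq
      with local s x d
    ... | away n _ r= _ = trans (cong (λ z → T (suc s) (z , _)) (sym (Sim.B-off (sim s x) d n)))
                                (Rep.at (T-rep (suc s)) d≤M x<k (trans r= rx))
    ... | stay _ refl _ _ _ = ⊥-elim (off (suc x) x<k (sym (cell-suc s x)))
    ... | land _ refl _ _ _ = ⊥-elim (off (suc x) x<k (sym (cell-suc s x)))
    ... | leave _ _ r0 _ _ = ⊥-elim (true≢false (trans (sym rx) r0))
    new⇒old : ∀ a → T (suc s) (r , c) ≡ just a → T s (r , c) ≡ just a
    new⇒old a eq with d , x , d≤M , x<k , refl , rx , refl , refl ← Rep.sound (T-rep (suc s)) r c _ eq
      with local s x d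
    ... | away n _ r= _ = trans (cong (λ z → T s (z , _)) (Sim.B-off (sim s x) d n))
                                (Rep.at (T-rep s) d≤M x<k (trans (sym r=) rx))
    ... | stay refl _ _ _ _ = ⊥-elim (off x (ℕ.<⇒≤ x<k) (sym (cell-B′ s x)))
    ... | leave refl _ _ _ _ = ⊥-elim (off x (ℕ.<⇒≤ x<k) (sym (cell-B′ s x)))
    ... | land _ _ _ r0 _ = ⊥-elim (true≢false (trans (sym rx) r0))

  column₀ : ∀ {F : Filling} {r} → F (r , cₘ ℤ.- + 0) ≡ F (r , cₘ)
  column₀ {F} {r} = cong (λ c → F (r , c)) (minus-zero cₘ)

  above-top : ∀ s r → r ℤ.< top s 0 → T s (r , cₘ) ≡ nothing
  above-top s r r<t = trans (sym (column₀ {T s})) (is-nothing λ a eq →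
    let x , _ , x<k , rx , req , _ = Rep.sound-at (T-rep s) 0 r a eq
    in ℤ.<-irrefl refl (ℤ.<-≤-trans r<t (subst (top s 0 ℤ.≤_) (sym req) (β-mono (top s 0) (R s 0) {0} {x} z≤n))))

  colSlide : ∀ s → ColSlide k (T s) (top s 0 ℤ.- + 1 , cₘ) (T (suc s))
  colSlide s =
    above-top s _ (subst (ℤ._< top s 0) (sym (minus-one (top s 0))) (pred-< _)) ,
    cell s , cong₂ _,_ (sym (minus-one (top s 0))) (minus-zero cₘ) ,
    firstGreater s , T′-cell s , T′-end s , off-path s

  topRow : ∀ s → TopRow (T s) cₘ (top s 0)
  topRow s = (suc y , trans (sym (column₀ {T s}))
              (trans (cong (λ z → T s (z , _)) (sym yt)) (Rep.at (T-rep s) z≤n (ℕ.≤-<-trans y≤x x<k) ry)))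
           , above-top s
    where
    x = proj₁ nonempty
    x<k = proj₁ (proj₂ nonempty)
    first = β-first (top s 0) (R s 0) x (C⇒R₀ s x (proj₂ (proj₂ nonempty)))
    y = proj₁ first
    y≤x = proj₁ (proj₂ first)
    ry = proj₁ (proj₂ (proj₂ first))
    yt = proj₂ (proj₂ (proj₂ first))

  total : ℕ
  total = missing k

  fullColumn : FullColumn k (T total) cₘ
  fullColumn = top total 0
    , (λ i i<k → trans (sym (column₀ {T total})) (trans (cong (λ z → T total (z , _)) (sym (rows i (ℕ.<⇒≤ i<k))))
                       (Rep.at (T-rep total) z≤n i<k (all i i<k))))
    , λ r′ (a , eq) → let x , _ , x<k , _ , req , _ = Rep.sound-at (T-rep total) 0 r′ a (trans (column₀ {T total}) eq)
                      in x , x<k , trans req (rows x (ℕ.<⇒≤ x<k))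
    where
    all : ∀ i → i ℕ.< k → R total 0 i ≡ true
    all = filled total k ℕ.≤-refl
    rows : ∀ i → i ℕ.≤ k → B total 0 i ≡ top total 0 ℤ.+ + i
    rows i i≤k = β-all (top total 0) (R total 0) i (λ j q → all j (ℕ.<-≤-trans q i≤k))

  ¬fullColumn : ∀ s → s ℕ.< total → ¬ FullColumn k (T s) cₘ
  ¬fullColumn s s<total (r , h , _) = ℕ.<-irrefl refl (ℕ.<-≤-trans s<total (filled⇒missing≤ s k bits))
    where
    bits : ∀ i → i ℕ.< k → R s 0 i ≡ true
    bits i i<k with x , _ , _ , rx , _ , refl ← Rep.sound-at (T-rep s) 0 _ _ (trans (column₀ {T s}) (h i i<k)) = rx

  run : ∀ n s → n ℕ.+ s ≡ total → SlideRun k cₘ n (T s) (T total)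
  run zero    s refl = stop fullColumn
  run (suc n) s eq   = slide (¬fullColumn s (subst (s ℕ.<_) eq (s≤s (ℕ.m≤n+m s n)))) (topRow s) (colSlide s)
                             (run n (suc s) (trans (ℕ.+-suc n s) eq))

-- Column extraction

minus-one-minus : ∀ c d → (c ℤ.- + 1) ℤ.- + d ≡ c ℤ.- + suc d
minus-one-minus c d = lemma c (+ d)
  where
  lemma : ∀ c d → (c ℤ.- + 1) ℤ.- d ≡ c ℤ.- (+ 1 ℤ.+ d)
  lemma = solve-∀

columnsWord : ℕ → (ℕ → ℕ → Bool) → ℕ → List ℕ
columnsWord k b zero    = []
columnsWord k b (suc n) = word (b n) k ++ columnsWord k b n

columnsWord-snoc : ∀ k b n → columnsWord k b (suc n) ≡ columnsWord k (λ d → b (suc d)) n ++ word (b 0) k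
columnsWord-snoc k b zero    = ++-identityʳ _
columnsWord-snoc k b (suc n) = trans (cong (word (b (suc n)) k ++_) (columnsWord-snoc k b n))
                                     (sym (++-assoc (word (b (suc n)) k) _ _))

columnsWord-cong : ∀ k {b b′} n → (∀ d → d ℕ.< n → b d ≡ b′ d) → columnsWord k b n ≡ columnsWord k b′ n
columnsWord-cong k zero    h = refl
columnsWord-cong k (suc n) h = cong₂ (λ f u → word f k ++ u) (h n ℕ.≤-refl) (columnsWord-cong k n (λ d q → h d (ℕ.m<n⇒m<1+n q)))

-- The invariant of the iteration. Columns other than the leftmost may be empty; they still carry a
-- top row, so that interlacing makes sense for them.
record State (k : ℕ) (rt : ℤ) (F : Filling) : Set where
  field
    cₘ     : ℤ
    m      : ℕ
    t      : ℕ → ℤ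
    b      : ℕ → ℕ → Bool
    rep    : Rep k cₘ m t b F
    inter  : ∀ d i → d ℕ.< m → β (t d) (b d) i ℤ.≤ β (t (suc d)) (b (suc d)) i
    left   : ∃[ x ] (x ℕ.< k) × (b m x ≡ true)
    corner : t m ≡ rt

  columns : List ℕ
  columns = columnsWord k b (suc m)

  inter-≤ : ∀ i {d d′} → d ℕ.≤ d′ → d′ ℕ.≤ m → β (t d) (b d) i ℤ.≤ β (t d′) (b d′) i
  inter-≤ i {d} {d′} q q′ with ℕ.m≤n⇒m<n∨m≡n q
  ... | inj₂ refl = ℤ.≤-refl
  inter-≤ i {d} {suc d′} q q′ | inj₁ (s≤s p) = ℤ.≤-trans (inter-≤ i p (ℕ.<⇒≤ q′)) (inter d′ i q′)

  top-cell : ∀ {d x} → d ℕ.≤ m → x ℕ.< k → b d x ≡ true → Occ F (t d , cₘ ℤ.- + d)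
  top-cell {d} {x} d≤m x<k bx with y , y≤x , by , yt ← β-first (t d) (b d) x bx =
    suc y , trans (cong (λ z → F (z , _)) (sym yt)) (Rep.at rep d≤m (ℕ.≤-<-trans y≤x x<k) by)

extend : {A : Set} → ℕ → (ℕ → A) → A → ℕ → A
extend m f z d with d ℕ.≤? m
... | yes _ = f d
... | no  _ = z

extend-in : {A : Set} → ∀ m (f : ℕ → A) z d → d ℕ.≤ m → extend m f z d ≡ f d
extend-in m f z d q with d ℕ.≤? m
... | yes _ = refl
... | no ¬q = ⊥-elim (¬q q)

extend-out : {A : Set} → ∀ m (f : ℕ → A) z d → m ℕ.< d → extend m f z d ≡ z
extend-out m f z d q with d ℕ.≤? m
... | yes p = ⊥-elim (ℕ.<-irrefl refl (ℕ.<-≤-trans q p))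
... | no _  = refl

all-true : ℕ → Bool
all-true _ = true

β≤full : ∀ z b i → β z b i ℤ.≤ β z all-true i
β≤full z b zero    = ℤ.≤-refl
β≤full z b (suc i) = ℤ.≤-trans (stepRow-≤ (b i) _) (ℤ.suc-mono (β≤full z b i))

-- A covering list in place of a count: its length bounds the number of higher columns, and a bound
-- is enough because extraction creates no new higher column.
Above : Filling → ℤ → List ℤ → Set
Above F rt L = ∀ r c → Occ F (r , c) → r ℤ.< rt → c ∈ L

module Extraction (k : ℕ) (rt : ℤ) (P : Filling) (st : State k rt P)
                  (right : ∃[ x ] (x ℕ.< k) × (State.b st 0 x ≡ true)) where
  open State st

  -- Column `m + 1` is the added full column. The later ones are copies of it, so that interlacing
  -- holds at every index.
  Ĉ : ℕ → ℕ → Bool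
  Ĉ = extend m b all-true

  t̂ : ℕ → ℤ
  t̂ = extend m t rt

  inter-extended : ∀ d i → β (t̂ d) (Ĉ d) i ℤ.≤ β (t̂ (suc d)) (Ĉ (suc d)) i
  inter-extended d i with ℕ.<-cmp d m
  ... | tri< d<m _ _ rewrite extend-in m b all-true d (ℕ.<⇒≤ d<m) | extend-in m t rt d (ℕ.<⇒≤ d<m)
                           | extend-in m b all-true (suc d) d<m | extend-in m t rt (suc d) d<m = inter d i d<m
  ... | tri≈ _ refl _ rewrite extend-in m b all-true d ℕ.≤-refl | extend-in m t rt d ℕ.≤-refl
                            | extend-out m b all-true (suc d) ℕ.≤-refl | extend-out m t rt (suc d) ℕ.≤-refl
                            | corner = β≤full rt (b d) i
  ... | tri> _ _ m<d rewrite extend-out m b all-true d m<d | extend-out m t rt d m<d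
                           | extend-out m b all-true (suc d) (ℕ.m<n⇒m<1+n m<d)
                           | extend-out m t rt (suc d) (ℕ.m<n⇒m<1+n m<d) = ℤ.≤-refl

  full : ∀ i → Ĉ (suc m) i ≡ true
  full i = cong (λ f → f i) (extend-out m b all-true (suc m) ℕ.≤-refl)

  right-extended : ∃[ x ] (x ℕ.< k) × (Ĉ 0 x ≡ true)
  right-extended = let x , x<k , bx = right in x , x<k , trans (cong (λ f → f x) (extend-in m b all-true 0 z≤n)) bx

  open Slides k cₘ Ĉ t̂ (suc m) full inter-extended right-extended

  Q : Filling
  Q = fill k (cₘ ℤ.- + 1) m (λ d → top total (suc d)) (λ d → R total (suc d))

  Q-rep : Rep k (cₘ ℤ.- + 1) m (λ d → top total (suc d)) (λ d → R total (suc d)) Q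
  Q-rep = fill-rep k (cₘ ℤ.- + 1) m _ _

  Q⇒T : ∀ r c a → Q (r , c) ≡ just a → T total (r , c) ≡ just a
  Q⇒T r c a eq with d , x , d≤m , x<k , refl , bx , refl , refl ← Rep.sound Q-rep r c a eq =
    Rep.complete (T-rep total) _ _ _ (suc d , x , s≤s d≤m , x<k , minus-one-minus cₘ d , bx , refl , refl)

  delete : DeleteColumn cₘ (T total) Q
  delete = (λ r → is-nothing λ a eq → gone r a eq) , λ r c c≢ → maybe-ext (Q⇒T r c) (λ a → kept r c a c≢)
    where
    gone : ∀ r a → Q (r , cₘ) ≢ just a
    gone r a eq with d , x , d≤m , x<k , ceq , _ ← Rep.sound Q-rep r cₘ a eq
      with () ← minus-cancel cₘ {0} {suc d} (trans (minus-zero cₘ) (trans ceq (minus-one-minus cₘ d)))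
    kept : ∀ r c a → c ≢ cₘ → T total (r , c) ≡ just a → Q (r , c) ≡ just a
    kept r c a c≢ eq with Rep.sound (T-rep total) r c a eq
    ... | zero , x , d≤m , x<k , ceq , bx , req , aeq = ⊥-elim (c≢ (trans ceq (minus-zero cₘ)))
    ... | suc d , x , s≤s d≤m , x<k , ceq , bx , req , aeq =
      Rep.complete Q-rep r c a (d , x , d≤m , x<k , trans ceq (sym (minus-one-minus cₘ d)) , bx , req , aeq)

  P⇒T₀ : ∀ r c a → P (r , c) ≡ just a → T 0 (r , c) ≡ just a
  P⇒T₀ r c a eq with d , x , d≤m , x<k , ceq , bx , req , aeq ← Rep.sound rep r c a eq =
    Rep.complete (T-rep 0) r c a (d , x , ℕ.m≤n⇒m≤1+n d≤m , x<k , ceq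
      , trans (R-zero d x) (trans (cong (λ f → f x) (extend-in m b all-true d d≤m)) bx)
      , trans req (trans (cong₂ (λ u v → β u v x) (sym (extend-in m t rt d d≤m)) (sym (extend-in m b all-true d d≤m)))
                         (sym (B-zero d x)))
      , aeq)

  B-last : ∀ i → B 0 (suc m) i ≡ rt ℤ.+ + i
  B-last i = trans (B-zero (suc m) i)
    (trans (cong₂ (λ u v → β u v i) (extend-out m t rt (suc m) ℕ.≤-refl) (extend-out m b all-true (suc m) ℕ.≤-refl))
           (β-all rt all-true i (λ _ _ → refl)))

  c₁ : ℤ
  c₁ = cₘ ℤ.- + m

  c₁-1 : c₁ ℤ.- + 1 ≡ cₘ ℤ.- + suc m
  c₁-1 = trans (minus-one c₁) (sym (ℤ.minus-suc cₘ m))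

  addColumn : AddFullColumn k c₁ rt P (T 0)
  addColumn = (λ i i<k → trans (cong₂ (λ r c → T 0 (r , c)) (sym (B-last i)) c₁-1)
                               (Rep.at (T-rep 0) ℕ.≤-refl i<k (trans (R-zero (suc m) i) (full i))))
            , λ (r , c) off → maybe-ext (λ a → back r c a off) (P⇒T₀ r c)
    where
    back : ∀ r c a → (∀ i → i ℕ.< k → (r , c) ≢ (rt ℤ.+ + i , c₁ ℤ.- + 1)) → T 0 (r , c) ≡ just a → P (r , c) ≡ just a
    back r c a off eq with d , x , d≤m , x<k , ceq , bx , req , aeq ← Rep.sound (T-rep 0) r c a eq
      with ℕ.m≤n⇒m<n∨m≡n d≤m
    ... | inj₂ refl = ⊥-elim (off x x<k (cong₂ _,_ (trans req (B-last x)) (trans ceq (sym c₁-1))))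
    ... | inj₁ (s≤s d≤m′) = Rep.complete rep r c a (d , x , d≤m′ , x<k , ceq
          , trans (sym (trans (R-zero d x) (cong (λ f → f x) (extend-in m b all-true d d≤m′)))) bx
          , trans req (trans (B-zero d x) (cong₂ (λ u v → β u v x) (extend-in m t rt d d≤m′) (extend-in m b all-true d d≤m′)))
          , aeq)

  leftmost : LeftmostCol P c₁
  leftmost = (t m , let x , x<k , bx = left in top-cell ℕ.≤-refl x<k bx) ,
    λ r c c<c₁ → is-nothing λ a eq →
      let d , _ , d≤m , _ , ceq , _ = Rep.sound rep r c a eq
      in ℤ.<-irrefl refl (ℤ.<-≤-trans (subst (ℤ._< c₁) ceq c<c₁) (minus-antimono cₘ d≤m))

  topRow₁ : TopRow P c₁ rt
  topRow₁ = subst (λ r → Occ P (r , c₁)) corner (proj₂ (proj₁ leftmost)) ,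
    λ r r<rt → is-nothing λ a eq →
      let x , _ , x<k , _ , req , _ = Rep.sound-at rep m r a eq
      in ℤ.<-irrefl refl (ℤ.<-≤-trans r<rt (subst₂ ℤ._≤_ corner (sym req) (β-mono (t m) (b m) {0} {x} z≤n)))

  rightmost : RightmostCol P cₘ
  rightmost = (t 0 , subst (λ c → Occ P (t 0 , c)) (minus-zero cₘ) (let x , x<k , bx = right in top-cell z≤n x<k bx)) ,
    λ r c cₘ<c → is-nothing λ a eq →
      let d , _ , d≤m , _ , ceq , _ = Rep.sound rep r c a eq
      in ℤ.<-irrefl refl (ℤ.<-≤-trans (subst (cₘ ℤ.<_) ceq cₘ<c)
                           (subst (cₘ ℤ.- + d ℤ.≤_) (minus-zero cₘ) (minus-antimono cₘ {0} {d} z≤n)))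

  extract : Extract k P Q
  extract = c₁ , rt , cₘ , T 0 , total , T total , leftmost , topRow₁ , rightmost , addColumn ,
            run total 0 (ℕ.+-identityʳ total) , missing≤ k , delete

  state : State k rt Q
  state = record
    { cₘ = cₘ ℤ.- + 1 ; m = m ; t = λ d → top total (suc d) ; b = λ d → R total (suc d) ; rep = Q-rep
    ; inter = λ d i _ → interlace total (suc d) i
    -- What remains of the full column is `E total (suc m)`, which keeps every value of the old
    -- leftmost column.
    ; left = let x , x<k , bx = left in x , x<k ,
        trans (R-M total x) (C⇒E total m x (trans (cong (λ f → f x) (extend-in m b all-true m ℕ.≤-refl)) bx))
    ; corner = trans (top-suc total m) (extend-out m t rt (suc m) ℕ.≤-refl) }

  -- A column is carried to the left through the others: at column `n + 1` the incoming
  -- `E total (suc n)` is traded for the outgoing `E total (suc (suc n))`, and `R total (suc n)`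
  -- stays behind.
  exchange : ∀ n → (columnsWord k (λ d → Ĉ (suc d)) n ++ word (E total 1) k)
                   ≈K (word (E total (suc n)) k ++ columnsWord k (λ d → R total (suc d)) n)
  exchange zero = ≡⇒≈K (sym (++-identityʳ _))
  exchange (suc n) =
    ktrans (≡⇒≈K (++-assoc (word (Ĉ (suc n)) k) _ _))
    (ktrans (≈K-prefix (word (Ĉ (suc n)) k) (exchange n))
    (ktrans (≡⇒≈K (sym (++-assoc (word (Ĉ (suc n)) k) _ _)))
    (ktrans (≈K-suffix (columnsWord k (λ d → R total (suc d)) n)
               (Scan.column-exchange (Ĉ (suc n)) (E total (suc n)) (U total (suc n)) (λ i → refl) refl k))
            (≡⇒≈K (++-assoc (word (E total (suc (suc n))) k) _ _)))))

  -- The carried column starts as the old rightmost column, by `E-one`, and ends as the new leftmost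
  -- one, by `R-M`. The added full column is absent from the first word and the deleted one from the
  -- second.
  knuth : columns ≈K State.columns state
  knuth = subst₂ _≈K_
    (trans (cong (columnsWord k (λ d → Ĉ (suc d)) m ++_) (word-cong k (E-one total k ℕ.≤-refl)))
      (trans (sym (columnsWord-snoc k Ĉ m)) (columnsWord-cong k (suc m) λ d d<m → extend-in m b all-true d (ℕ.s≤s⁻¹ d<m))))
    (cong (_++ columnsWord k (λ d → R total (suc d)) m) (word-cong k (λ i _ → sym (R-M total i))))
    (exchange m)

  -- A nonempty column of `Q` other than its leftmost one was nonempty in `P` and has kept its top.
  -- The leftmost one is excluded because its top is `rt`.
  above-P : ∀ r c → Occ Q (r , c) → r ℤ.< rt →
            ∃[ d ] (suc d ℕ.≤ m) × (c ≡ cₘ ℤ.- + suc d) × (t (suc d) ℤ.< rt) × Occ P (t (suc d) , c)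
  above-P r c (a , eq) r<rt with d , x , d≤m , x<k , ceq , rx , req , aeq ← Rep.sound Q-rep r c a eq
    with y , y≤x , cy ← R⇒entry total d x rx
    with ℕ.m≤n⇒m<n∨m≡n d≤m | ℤ.≤-<-trans (subst₂ ℤ._≤_ (top-suc total d) (sym req)
                         (β-mono (top total (suc d)) (R total (suc d)) {0} {x} z≤n)) r<rt
  ... | inj₂ refl | lt = ⊥-elim (ℤ.<-irrefl refl (subst (ℤ._< rt) (extend-out m t rt (suc m) ℕ.≤-refl) lt))
  ... | inj₁ d<m | lt = d , d<m , trans ceq (minus-one-minus cₘ d) , subst (ℤ._< rt) (extend-in m t rt (suc d) d<m) lt
      , subst (λ z → Occ P (t (suc d) , z)) (sym (trans ceq (minus-one-minus cₘ d)))
          (top-cell d<m (ℕ.≤-<-trans y≤x x<k) (trans (cong (λ f → f y) (sym (extend-in m b all-true (suc d) d<m))) cy))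

  -- Tops descend to the left, so if the rightmost column is not higher than `rt`, no column is.
  -- Otherwise `cₘ` belongs to `L`, and it can be removed since `Q` has lost that column.
  fewer : ∀ L n → Above P rt L → length L ℕ.≤ suc n → ∃[ L′ ] Above Q rt L′ × (length L′ ℕ.≤ n)
  fewer L n abv len with t 0 ℤ.<? rt
  ... | no t₀≮ = [] , (λ r c occ r<rt → let d , d<m , _ , lt , _ = above-P r c occ r<rt
                     in ⊥-elim (t₀≮ (ℤ.≤-<-trans (inter-≤ 0 {0} {suc d} z≤n d<m) lt))) , z≤n
  ... | yes t₀< = filter notₘ L
      , (λ r c occ r<rt → let d , d<m , ceq , lt , occP = above-P r c occ r<rt in
          ∈-filter⁺ notₘ (abv _ c occP lt) λ c≡ → case-zero d
            (minus-cancel cₘ {suc d} {0} (trans (sym ceq) (trans c≡ (sym (minus-zero cₘ))))))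
      , ℕ.s≤s⁻¹ (ℕ.<-≤-trans (filter-notAll notₘ L
                (Any.map (λ c≡ n → n (sym c≡)) (abv _ cₘ (proj₂ (proj₁ rightmost)) t₀<))) len)
    where
    notₘ = λ c → ¬? (c ℤ.≟ cₘ)
    case-zero : ∀ d → suc d ≢ 0
    case-zero d ()

trim : ∀ {k rt P} (st : State k rt P) → Σ (State k rt P) λ st′ →
       (∃[ x ] (x ℕ.< k) × (State.b st′ 0 x ≡ true)) × (State.columns st ≡ State.columns st′)
trim {k} {rt} {P} st = go (State.m st) st refl
  where
  nonempty? : ∀ (b : ℕ → Bool) n → (∃[ x ] (x ℕ.< n) × (b x ≡ true)) ⊎ (∀ x → x ℕ.< n → b x ≡ false)
  nonempty? b zero = inj₂ λ x ()
  nonempty? b (suc n) with b n in bn | nonempty? b n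
  ... | true  | _ = inj₁ (n , ℕ.≤-refl , bn)
  ... | false | inj₁ (x , q , bx) = inj₁ (x , ℕ.m<n⇒m<1+n q , bx)
  ... | false | inj₂ h = inj₂ h′
    where
    h′ : ∀ x → x ℕ.< suc n → b x ≡ false
    h′ x (s≤s q) with ℕ.m≤n⇒m<n∨m≡n q
    ... | inj₁ x<n  = h x x<n
    ... | inj₂ refl = bn
  word-empty : ∀ (b : ℕ → Bool) n → (∀ x → x ℕ.< n → b x ≡ false) → word b n ≡ []
  word-empty b zero    h = refl
  word-empty b (suc n) h rewrite h n ℕ.≤-refl = word-empty b n (λ x q → h x (ℕ.m<n⇒m<1+n q))
  go : ∀ n (st : State k rt P) → State.m st ≡ n → Σ (State k rt P) λ st′ →
       (∃[ x ] (x ℕ.< k) × (State.b st′ 0 x ≡ true)) × (State.columns st ≡ State.columns st′)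
  go n st eq with nonempty? (State.b st 0) k
  go n st eq | inj₁ right = st , right , refl
  go zero st refl | inj₂ h with x , x<k , bx ← State.left st = ⊥-elim (true≢false (trans (sym bx) (h x x<k)))
  go (suc n) st refl | inj₂ h =
    let st′ , right , weq = go n smaller refl
    in st′ , right , trans (trans (columnsWord-snoc k b (suc n))
                             (trans (cong (State.columns smaller ++_) (word-empty (b 0) k h)) (++-identityʳ _))) weq
    where
    open State st
    smaller : State k rt P
    smaller = record
      { cₘ = cₘ ℤ.- + 1 ; m = n ; t = λ d → t (suc d) ; b = λ d → b (suc d)
      ; rep = record { sound = snd ; complete = λ { r c a (d , x , d≤ , x<k , ceq , rest) →
                         Rep.complete rep r c a (suc d , x , s≤s d≤ , x<k , trans ceq (minus-one-minus cₘ d) , rest) } }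
      ; inter = λ d i q → inter (suc d) i (s≤s q)
      ; left = left ; corner = corner }
      where
      snd : ∀ r c a → P (r , c) ≡ just a → HasEntry k (cₘ ℤ.- + 1) n (λ d → t (suc d)) (λ d → b (suc d)) r c a
      snd r c a eq with Rep.sound rep r c a eq
      ... | zero , x , _ , x<k , _ , bx , _ = ⊥-elim (true≢false (trans (sym bx) (h x x<k)))
      ... | suc d , x , s≤s d≤ , x<k , ceq , rest = d , x , d≤ , x<k , trans ceq (sym (minus-one-minus cₘ d)) , rest

iterate : ∀ k rt j P L (st : State k rt P) → Above P rt L → length L ℕ.≤ j →
          ∃[ Q ] Iterate (Extract k) j P Q × Σ (State k rt Q) λ st′ →
            Above Q rt [] × (State.columns st ≈K State.columns st′)
iterate k rt zero    P [] st abv len = P , iter-zero , st , abv , krefl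
iterate k rt (suc j) P L  st abv len =
  let st₀ , right , weq = trim st
      open Extraction k rt P st₀ right
      L′ , abv′ , len′ = fewer L j abv len
      Q′ , its , st′ , abv″ , kn = iterate k rt j Q L′ state abv′ len′
  in Q′ , iter-suc extract its , st′ , abv″ , ktrans (≡⇒≈K weq) (ktrans knuth kn)

-- Reading words

cat : (ℕ → List ℕ) → ℕ → List ℕ
cat f zero    = []
cat f (suc n) = f 0 ++ cat (λ j → f (suc j)) n

concatMap-applyUpTo : ∀ (f : ℕ → List ℕ) (g : ℕ → ℕ) n → concatMap f (applyUpTo g n) ≡ cat (λ j → f (g j)) n
concatMap-applyUpTo f g zero    = refl
concatMap-applyUpTo f g (suc n) = cong (f (g 0) ++_) (concatMap-applyUpTo f (λ j → g (suc j)) n)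

columnWord : (ℕ → Maybe ℕ) → ℕ → List ℕ
columnWord g zero    = []
columnWord g (suc h) = maybeToList (g h) ++ columnWord g h

rowsWord : (ℕ → ℕ → Maybe ℕ) → ℕ → ℕ → List ℕ
rowsWord G n zero    = []
rowsWord G n (suc h) = cat (λ j → maybeToList (G h j)) n ++ rowsWord G n h

boxWord≡rowsWord : ∀ F rlo h clo w →
  boxWord F rlo h clo w ≡ rowsWord (λ i j → F (rlo ℤ.+ + i , clo ℤ.+ + j)) w h
boxWord≡rowsWord F rlo h clo w = trans (cong (concatMap row′) (reverse-upTo h)) (go h)
  where
  row′ : ℕ → List ℕ
  row′ i = concatMap (λ j → maybeToList (F (rlo ℤ.+ + i , clo ℤ.+ + j))) (upTo w)
  go : ∀ h → concatMap row′ (downFrom h) ≡ rowsWord (λ i j → F (rlo ℤ.+ + i , clo ℤ.+ + j)) w h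
  go zero    = refl
  go (suc h) = cong₂ _++_ (concatMap-applyUpTo _ (λ j → j) w) (go h)

record SkewGrid (G : ℕ → ℕ → Maybe ℕ) : Set where
  field
    column-< : ∀ {i i′ j a b} → i ℕ.< i′ → G i j ≡ just a → G i′ j ≡ just b → a ℕ.< b
    row-≤    : ∀ {i j j′ a b} → j ℕ.< j′ → G i j ≡ just a → G i j′ ≡ just b → a ℕ.≤ b
    ends     : ∀ {i i′ j j′ a} → i ℕ.< i′ → G i j ≡ just a → G i′ j ≡ nothing → j ℕ.< j′ → G i′ j′ ≡ nothing

tail-grid : ∀ {G} → SkewGrid G → SkewGrid (λ i j → G i (suc j))
tail-grid g = record { column-< = column-< ; row-≤ = λ q → row-≤ (s≤s q) ; ends = λ q e n q′ → ends q e n (s≤s q′) }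
  where open SkewGrid g

columnWord-desc : ∀ (g : ℕ → Maybe ℕ) → (∀ {i i′ a b} → i ℕ.< i′ → g i ≡ just a → g i′ ≡ just b → a ℕ.< b) →
                  ∀ h b → (∀ i a → i ℕ.< h → g i ≡ just a → a ℕ.< b) → Desc b (columnWord g h)
columnWord-desc g strict zero    b below = tt
columnWord-desc g strict (suc h) b below with g h in eq
... | nothing = columnWord-desc g strict h b (λ i a q → below i a (ℕ.m<n⇒m<1+n q))
... | just a  = below h a ℕ.≤-refl eq , columnWord-desc g strict h a (λ i a′ q e → strict q e eq)

columnWord-empty? : ∀ (g : ℕ → Maybe ℕ) h → columnWord g h ≡ [] ⊎ ∃[ i ] ∃[ a ] (i ℕ.< h) × (g i ≡ just a)
columnWord-empty? g zero = inj₁ refl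
columnWord-empty? g (suc h) with g h in eq
... | just a = inj₂ (h , a , ℕ.≤-refl , eq)
... | nothing with columnWord-empty? g h
...   | inj₁ e = inj₁ e
...   | inj₂ (i , a , q , e) = inj₂ (i , a , ℕ.m<n⇒m<1+n q , e)

row-asc : ∀ (g : ℕ → Maybe ℕ) → (∀ {j j′ a b} → j ℕ.< j′ → g j ≡ just a → g j′ ≡ just b → a ℕ.≤ b) →
          ∀ n b → (∀ j a → g j ≡ just a → b ℕ.≤ a) → Asc b (cat (λ j → maybeToList (g j)) n)
row-asc g weak zero    b bound = tt
row-asc g weak (suc n) b bound with g 0 in eq
... | nothing = row-asc (λ j → g (suc j)) (λ q → weak (s≤s q)) n b (λ j → bound (suc j))
... | just a  = bound 0 a eq , row-asc (λ j → g (suc j)) (λ q → weak (s≤s q)) n a (λ j a′ → weak (s≤s z≤n) eq)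

row-empty : ∀ (g : ℕ → Maybe ℕ) n → (∀ j → g j ≡ nothing) → cat (λ j → maybeToList (g j)) n ≡ []
row-empty g zero    h = refl
row-empty g (suc n) h rewrite h 0 = row-empty (λ j → g (suc j)) n (λ j → h (suc j))

-- The rest of the row has to pass the first column. If that column has a bottom entry, this is the
-- pivot of `row-column-swap`; if it has already ended, `ends` makes the rest of the row empty; if
-- it has no cells above, there is nothing to pass.
add-bottom-row : ∀ {G} → SkewGrid G → ∀ h n →
  (cat (λ j → maybeToList (G h j)) n ++ cat (λ j → columnWord (λ i → G i j) h) n)
  ≈K cat (λ j → columnWord (λ i → G i j) (suc h)) n
add-bottom-row g h zero = krefl
add-bottom-row {G} g h (suc n) =
  ktrans (≡⇒≈K (trans (++-assoc first rest _) (cong (first ++_) (sym (++-assoc rest col₀ cols)))))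
  (ktrans (≡⇒≈K (sym (++-assoc first (rest ++ col₀) cols)))
  (ktrans (≈K-suffix cols swap)
  (ktrans (≡⇒≈K (trans (++-assoc first (col₀ ++ rest) cols)
                  (trans (cong (first ++_) (++-assoc col₀ rest cols)) (sym (++-assoc first col₀ (rest ++ cols))))))
          (≈K-prefix (first ++ col₀) (add-bottom-row (tail-grid g) h n)))))
  where
  open SkewGrid g
  first = maybeToList (G h 0)
  rest  = cat (λ j → maybeToList (G h (suc j))) n
  col₀  = columnWord (λ i → G i 0) h
  cols  = cat (λ j → columnWord (λ i → G i (suc j)) h) n
  swap : (first ++ rest ++ col₀) ≈K (first ++ col₀ ++ rest)
  swap with columnWord-empty? (λ i → G i 0) h
  ... | inj₁ e rewrite e | ++-identityʳ rest = krefl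
  ... | inj₂ (i , a , i<h , e) with G h 0 in eq
  ...   | nothing rewrite row-empty (λ j → G h (suc j)) n (λ j → ends i<h e eq (s≤s z≤n)) | ++-identityʳ col₀ = krefl
  ...   | just b = row-column-swap rest col₀
          (row-asc (λ j → G h (suc j)) (λ q → row-≤ (s≤s q)) n b (λ j a → row-≤ (s≤s z≤n) eq))
          (columnWord-desc (λ i → G i 0) column-< h b (λ i a q e → column-< q e eq))

rows≈columns : ∀ {G} → SkewGrid G → ∀ n h → rowsWord G n h ≈K cat (λ j → columnWord (λ i → G i j) h) n
rows≈columns g n zero    = ≡⇒≈K (empty n)
  where
  empty : ∀ n → [] ≡ cat (λ j → []) n
  empty zero    = refl
  empty (suc n) = empty n
rows≈columns {G} g n (suc h) =
  ktrans (≈K-prefix (cat (λ j → maybeToList (G h j)) n) (rows≈columns g n h)) (add-bottom-row g h n)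

≤⇒offset : ∀ {x y} → x ℤ.≤ y → ∃[ n ] y ≡ x ℤ.+ + n
≤⇒offset {x} {y} q with y ℤ.- x in eq | ℤ.i≤j⇒0≤j-i q
... | + n | _ = n , trans (split x y) (cong (λ z → x ℤ.+ z) eq)
  where
  split : ∀ x y → y ≡ x ℤ.+ (y ℤ.- x)
  split = solve-∀

offset-cancel : ∀ z {i j} → z ℤ.+ + i ≡ z ℤ.+ + j → i ≡ j
offset-cancel z eq = ℤ.+-injective (+-cancelˡ z _ _ eq)

offset-mono-< : ∀ z {i j} → i ℕ.< j → z ℤ.+ + i ℤ.< z ℤ.+ + j
offset-mono-< z q = ℤ.+-monoʳ-< z (ℤ.+<+ q)

offset-cancel-< : ∀ z {i j} → z ℤ.+ + i ℤ.< z ℤ.+ + j → i ℕ.< j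
offset-cancel-< z {i} {j} q with i ℕ.<? j
... | yes p = p
... | no ¬p = ⊥-elim (ℤ.<-irrefl refl (ℤ.<-≤-trans q (ℤ.+-monoʳ-≤ z (ℤ.+≤+ (ℕ.≮⇒≥ ¬p)))))

<-suc : ∀ z → z ℤ.< ℤ.suc z
<-suc z = ℤ.suc[i]≤j⇒i<j ℤ.≤-refl

-- The boundary moves by at most one row per value, so it meets every row on its way.
β-hits : ∀ t b k r → t ℤ.≤ r → r ℤ.< β t b k → ∃[ y ] (y ℕ.< k) × (b y ≡ true) × (β t b y ≡ r)
β-hits t b zero    r t≤r r<t = ⊥-elim (ℤ.<-irrefl refl (ℤ.≤-<-trans t≤r r<t))
β-hits t b (suc k) r t≤r r< with r ℤ.<? β t b k
... | yes lt = let y , q , rest = β-hits t b k r t≤r lt in y , ℕ.m<n⇒m<1+n q , rest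
... | no ¬lt with b k in bk
...   | false = ⊥-elim (¬lt r<)
...   | true  = k , ℕ.≤-refl , bk , ℤ.≤-antisym (ℤ.≮⇒≥ ¬lt)
                  (subst (r ℤ.≤_) (ℤ.pred-suc _) (ℤ.i<j⇒i≤pred[j] r<))

module Reading {k : ℕ} {rt : ℤ} {F : Filling} (st : State k rt F) where
  open State st

  β-cancel-< : ∀ d {x y} → β (t d) (b d) x ℤ.< β (t d) (b d) y → x ℕ.< y
  β-cancel-< d {x} {y} lt with x ℕ.<? y
  ... | yes p = p
  ... | no ¬p = ⊥-elim (ℤ.<-irrefl refl (ℤ.<-≤-trans lt (β-mono (t d) (b d) (ℕ.≮⇒≥ ¬p))))

  bottom : ℕ → ℤ
  bottom d = β (t d) (b d) k

  entry-end : ∀ {d x} → b d x ≡ true → β (t d) (b d) (suc x) ≡ ℤ.suc (β (t d) (b d) x)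
  entry-end {d} {x} bx = cong (λ v → stepRow v (β (t d) (b d) x)) bx

  below-bottom : ∀ {d x} → x ℕ.< k → b d x ≡ true → β (t d) (b d) x ℤ.< bottom d
  below-bottom {d} x<k bx = β-strict (t d) (b d) bx x<k

  occupied : ∀ d r → d ℕ.≤ m → t d ℤ.≤ r → r ℤ.< bottom d → Occ F (r , cₘ ℤ.- + d)
  occupied d r d≤m t≤r r<b with y , y<k , by , yr ← β-hits (t d) (b d) k r t≤r r<b =
    suc y , trans (cong (λ z → F (z , _)) (sym yr)) (Rep.at rep d≤m y<k by)

  minus-cancel-< : ∀ {d d′} → cₘ ℤ.- + d ℤ.< cₘ ℤ.- + d′ → d′ ℕ.< d
  minus-cancel-< {d} {d′} lt = ℕ.≤∧≢⇒< (minus-cancel-≤ cₘ (ℤ.<⇒≤ lt)) λ { refl → ℤ.<-irrefl refl lt }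

  F-column-< : ∀ {r r′ c a a′} → r ℤ.< r′ → F (r , c) ≡ just a → F (r′ , c) ≡ just a′ → a ℕ.< a′
  F-column-< lt eq eq′ with d , x , d≤m , x<k , refl , bx , refl , refl ← Rep.sound rep _ _ _ eq
    with x′ , _ , _ , _ , refl , refl ← Rep.sound-at rep d _ _ eq′ = s≤s (β-cancel-< d lt)

  -- Interlacing at the level of the right entry: the right column reaches past row `r` with values
  -- up to that entry, hence so does the left column, whose entry in row `r` is thus no larger.
  F-row-≤ : ∀ {r c c′ a a′} → c ℤ.< c′ → F (r , c) ≡ just a → F (r , c′) ≡ just a′ → a ℕ.≤ a′
  F-row-≤ {r} lt eq eq′ with d , x , d≤m , x<k , refl , bx , req , refl ← Rep.sound rep _ _ _ eq
    with d′ , x′ , d′≤m , x′<k , refl , bx′ , req′ , refl ← Rep.sound rep _ _ _ eq′ =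
    β-cancel-< d (subst₂ ℤ._<_ req refl (ℤ.<-≤-trans (<-suc r)
      (subst (ℤ._≤ β (t d) (b d) (suc x′)) (trans (entry-end {d′} {x′} bx′) (cong ℤ.suc (sym req′)))
        (inter-≤ (suc x′) (ℕ.<⇒≤ (minus-cancel-< lt)) d≤m))))

  F-ends : ∀ {r r′ c c′ a} → r ℤ.< r′ → F (r , c) ≡ just a → F (r′ , c) ≡ nothing → c ℤ.< c′ → F (r′ , c′) ≡ nothing
  F-ends {r} {r′} lt eq none lt′ = is-nothing λ a′ eq′ → absurd a′ eq′
    where
    absurd : ∀ a′ → F (r′ , _) ≢ just a′
    absurd a′ eq′ with d , x , d≤m , x<k , refl , bx , req , _ ← Rep.sound rep _ _ _ eq
      with d′ , x′ , d′≤m , x′<k , refl , bx′ , req′ , _ ← Rep.sound rep _ _ _ eq′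
      with a″ , occ ← occupied d r′ d≤m
             (ℤ.<⇒≤ (ℤ.≤-<-trans (subst (t d ℤ.≤_) (sym req) (β-mono (t d) (b d) {0} {x} z≤n)) lt))
             (subst (ℤ._< bottom d) (sym req′)
               (ℤ.<-≤-trans (below-bottom x′<k bx′) (inter-≤ k (ℕ.<⇒≤ (minus-cancel-< lt′)) d≤m)))
      with () ← trans (sym occ) none

  columnStrict : ColumnStrict F
  columnStrict = (λ r c _ _ → F-row-≤ (subst (c ℤ.<_) (sym (plus-one c)) (<-suc c)))
               , (λ r c _ _ → F-column-< (subst (r ℤ.<_) (sym (plus-one r)) (<-suc r)))

  c₁ : ℤ
  c₁ = cₘ ℤ.- + m

  grid : SkewGrid (λ i j → F (t 0 ℤ.+ + i , c₁ ℤ.+ + j))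
  grid = record { column-< = λ q → F-column-< (offset-mono-< (t 0) q)
                ; row-≤ = λ q → F-row-≤ (offset-mono-< c₁ q)
                ; ends = λ q e n q′ → F-ends (offset-mono-< (t 0) q) e n (offset-mono-< c₁ q′) }

  -- By interlacing column 0 has the highest top and column `m` the lowest bottom, so these two
  -- bound the box.
  height : ∃[ h ] bottom m ≡ t 0 ℤ.+ + h
  height = ≤⇒offset (ℤ.≤-trans (inter-≤ 0 {0} {m} z≤n ℕ.≤-refl) (β-mono (t m) (b m) {0} {k} z≤n))

  H : ℕ
  H = proj₁ height

  columnWord-prefix : ∀ (g : ℕ → Maybe ℕ) n h → n ℕ.≤ h → (∀ i → n ℕ.≤ i → g i ≡ nothing) → columnWord g h ≡ columnWord g n
  columnWord-prefix g n h n≤h none with ℕ.m≤n⇒m<n∨m≡n n≤h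
  ... | inj₂ refl = refl
  columnWord-prefix g n (suc h) n≤h none | inj₁ (s≤s q) rewrite none h q = columnWord-prefix g n h q none

  columnWord-none : ∀ (g : ℕ → Maybe ℕ) n → (∀ i → i ℕ.< n → g i ≡ nothing) → columnWord g n ≡ []
  columnWord-none g zero    none = refl
  columnWord-none g (suc n) none rewrite none n ℕ.≤-refl = columnWord-none g n (λ i q → none i (ℕ.m<n⇒m<1+n q))

  module _ (d : ℕ) (d≤m : d ℕ.≤ m) where
    private
      g : ℕ → Maybe ℕ
      g i = F (t 0 ℤ.+ + i , cₘ ℤ.- + d)

    column-upto : ∀ x → x ℕ.≤ k → ∃[ n ] (β (t d) (b d) x ≡ t 0 ℤ.+ + n) × (columnWord g n ≡ word (b d) x)
    column-upto zero _ with n , eq ← ≤⇒offset (inter-≤ 0 {0} {d} z≤n d≤m) =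
      n , eq , columnWord-none g n λ i i<n → is-nothing λ a e →
        let x , _ , _ , _ , req , _ = Rep.sound-at rep d _ a e
        in ℤ.<-irrefl refl (ℤ.≤-<-trans (subst₂ ℤ._≤_ eq (sym req) (β-mono (t d) (b d) {0} {x} z≤n)) (offset-mono-< (t 0) i<n))
    column-upto (suc x) x<k with n , eq , weq ← column-upto x (ℕ.<⇒≤ x<k) with b d x in bx
    ... | false = n , eq , weq
    ... | true  = suc n , trans (cong ℤ.suc eq) (suc-offset (t 0) n)
                , cong₂ (λ u v → maybeToList u ++ v) (trans (cong (λ z → F (z , _)) (sym eq)) (Rep.at rep d≤m x<k bx)) weq

    column-word : columnWord g H ≡ word (b d) k
    column-word with n , eq , weq ← column-upto k ℕ.≤-refl =
      trans (columnWord-prefix g n H n≤H none) weq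
      where
      n≤H : n ℕ.≤ H
      n≤H = ℕ.≮⇒≥ λ H<n → ℤ.<-irrefl refl (ℤ.<-≤-trans (offset-mono-< (t 0) H<n)
              (subst₂ ℤ._≤_ eq (proj₂ height) (inter-≤ k d≤m ℕ.≤-refl)))
      none : ∀ i → n ℕ.≤ i → g i ≡ nothing
      none i n≤i = is-nothing λ a e →
        let x , _ , x<k , bx , req , _ = Rep.sound-at rep d _ a e
        in ℤ.<-irrefl refl (ℤ.<-≤-trans (subst₂ ℤ._<_ (sym req) eq (below-bottom x<k bx)) (ℤ.+-monoʳ-≤ (t 0) (ℤ.+≤+ n≤i)))

  -- The coordinates are given by a function `c` so that the induction can shift it. With `n`
  -- columns left the first has index `n - 1`, whence the `suc j`.
  columns-cat : ∀ n → n ℕ.≤ suc m → (c : ℕ → ℤ) → (∀ j → c j ≡ (cₘ ℤ.+ + suc j) ℤ.- + n) →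
                cat (λ j → columnWord (λ i → F (t 0 ℤ.+ + i , c j)) H) n ≡ columnsWord k b n
  columns-cat zero    _ c h = refl
  columns-cat (suc n) (s≤s n≤m) c h =
    cong₂ _++_ (trans (cong (λ z → columnWord (λ i → F (t 0 ℤ.+ + i , z)) H) (trans (h 0) (start cₘ (+ n)))) (column-word n n≤m))
               (columns-cat n (ℕ.m≤n⇒m≤1+n n≤m) (λ j → c (suc j)) (λ j → trans (h (suc j)) (next cₘ (+ suc j) (+ n))))
    where
    start : ∀ c n → (c ℤ.+ + 1) ℤ.- (+ 1 ℤ.+ n) ≡ c ℤ.- n
    start = solve-∀
    next : ∀ c j n → (c ℤ.+ (+ 1 ℤ.+ j)) ℤ.- (+ 1 ℤ.+ n) ≡ (c ℤ.+ j) ℤ.- n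
    next = solve-∀

  offset-column : ∀ d → d ℕ.≤ m → cₘ ℤ.- + d ≡ c₁ ℤ.+ + (m ℕ.∸ d)
  offset-column d d≤m = trans (lemma cₘ (+ (m ℕ.∸ d)) (+ d)) (cong (λ z → (cₘ ℤ.- + z) ℤ.+ + (m ℕ.∸ d)) (ℕ.m∸n+n≡m d≤m))
    where
    lemma : ∀ c e d → c ℤ.- d ≡ (c ℤ.- (e ℤ.+ d)) ℤ.+ e
    lemma = solve-∀

  readingWord : ∃[ u ] ReadingWord F u × (u ≈K columns)
  readingWord = boxWord F (t 0) H c₁ (suc m) , (t 0 , H , c₁ , suc m , inBox , refl) ,
    ktrans (≡⇒≈K (boxWord≡rowsWord F (t 0) H c₁ (suc m)))
    (ktrans (rows≈columns grid (suc m) H)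
            (≡⇒≈K (columns-cat (suc m) ℕ.≤-refl (λ j → c₁ ℤ.+ + j) (λ j → position cₘ (+ m) (+ j)))))
    where
    position : ∀ c m j → (c ℤ.- m) ℤ.+ j ≡ (c ℤ.+ (+ 1 ℤ.+ j)) ℤ.- (+ 1 ℤ.+ m)
    position = solve-∀
    inBox : ∀ e → Occ F e → InBox (t 0) H c₁ (suc m) e
    inBox (r , c) (a , eq) with d , x , d≤m , x<k , refl , bx , refl , _ ← Rep.sound rep r c a eq
      with i , ieq ← ≤⇒offset (ℤ.≤-trans (inter-≤ 0 {0} {d} z≤n d≤m) (β-mono (t d) (b d) {0} {x} z≤n)) =
      i , m ℕ.∸ d
        , offset-cancel-< (t 0) (subst₂ ℤ._<_ ieq (proj₂ height) (ℤ.<-≤-trans (below-bottom x<k bx) (inter-≤ k d≤m ℕ.≤-refl)))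
        , s≤s (ℕ.m∸n≤m m d) , ieq , offset-column d d≤m

-- Straight and skew shapes

prefixLength : (ℕ → Bool) → ℕ → ℕ
prefixLength f zero    = 0
prefixLength f (suc n) with f 0
... | true  = suc (prefixLength (λ i → f (suc i)) n)
... | false = 0

prefixLength-sound : ∀ f n i → i ℕ.< prefixLength f n → (f i ≡ true) × (i ℕ.< n)
prefixLength-sound f (suc n) i q with f 0 in f0
prefixLength-sound f (suc n) zero    q       | true = f0 , s≤s z≤n
prefixLength-sound f (suc n) (suc i) (s≤s q) | true =
  let fi , i<n = prefixLength-sound (λ i → f (suc i)) n i q in fi , s≤s i<n

prefixLength-complete : ∀ f n i → (∀ i → f (suc i) ≡ true → f i ≡ true) → i ℕ.< n → f i ≡ true → i ℕ.< prefixLength f n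
prefixLength-complete f (suc n) i down i<n fi with f 0 in f0
prefixLength-complete f (suc n) zero    down i<n       fi | true = s≤s z≤n
prefixLength-complete f (suc n) (suc i) down (s≤s i<n) fi | true =
  s≤s (prefixLength-complete (λ i → f (suc i)) n i (λ i → down (suc i)) i<n fi)
prefixLength-complete f (suc n) i down i<n fi | false = ⊥-elim (true≢false (trans (sym (to-zero i fi)) f0))
  where
  to-zero : ∀ i → f i ≡ true → f 0 ≡ true
  to-zero zero    fi = fi
  to-zero (suc i) fi = to-zero i (down i fi)

prefixLength-mono : ∀ f g n → (∀ i → f i ≡ true → g i ≡ true) → prefixLength f n ℕ.≤ prefixLength g n
prefixLength-mono f g zero    f⇒g = z≤n
prefixLength-mono f g (suc n) f⇒g with f 0 in f0
... | false = z≤n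
... | true rewrite f⇒g 0 f0 = s≤s (prefixLength-mono (λ i → f (suc i)) (λ i → g (suc i)) n (λ i → f⇒g (suc i)))

part-applyUpTo : ∀ (g : ℕ → ℕ) k i → i ℕ.< k → part (applyUpTo g k) i ≡ g i
part-applyUpTo g (suc k) zero    q       = refl
part-applyUpTo g (suc k) (suc i) (s≤s q) = part-applyUpTo (λ i → g (suc i)) k i q

part-beyond : ∀ l i → length l ℕ.≤ i → part l i ≡ 0
part-beyond []      i       q       = refl
part-beyond (x ∷ l) (suc i) (s≤s q) = part-beyond l i q

part-applyUpTo-beyond : ∀ (g : ℕ → ℕ) k i → k ℕ.≤ i → part (applyUpTo g k) i ≡ 0
part-applyUpTo-beyond g zero    i       q       = refl
part-applyUpTo-beyond g (suc k) (suc i) (s≤s q) = part-applyUpTo-beyond (λ i → g (suc i)) k i q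

is-just-true : ∀ {m : Maybe ℕ} → is-just m ≡ true → ∃[ a ] m ≡ just a
is-just-true {just a} _ = a , refl

is-just-occ : ∀ {m : Maybe ℕ} → (∃[ a ] m ≡ just a) → is-just m ≡ true
is-just-occ (a , refl) = refl

module Straight {k : ℕ} {rt : ℤ} {F : Filling} (st : State k rt F) (none-above : Above F rt []) where
  open State st
  open Reading st

  top≤ : ∀ d → d ℕ.≤ m → t d ℤ.≤ rt
  top≤ d d≤m = subst (t d ℤ.≤_) corner (inter-≤ 0 d≤m ℕ.≤-refl)

  occ⇒ : ∀ d r → Occ F (r , cₘ ℤ.- + d) → r ℤ.< bottom d
  occ⇒ d r (a , eq) with x , _ , x<k , bx , refl , _ ← Rep.sound-at rep d r a eq = below-bottom x<k bx

  ⇒occ : ∀ d i → d ℕ.≤ m → rt ℤ.+ + i ℤ.< bottom d → Occ F (rt ℤ.+ + i , cₘ ℤ.- + d)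
  ⇒occ d i d≤m = occupied d _ d≤m (ℤ.≤-trans (top≤ d d≤m) (ℤ.i≤i+j rt (+ i)))

  column-of : ∀ r j → Occ F (r , c₁ ℤ.+ + j) → (j ℕ.≤ m) × (c₁ ℤ.+ + j ≡ cₘ ℤ.- + (m ℕ.∸ j))
  column-of r j (a , eq) with d , _ , d≤m , _ , ceq , _ ← Rep.sound rep r _ a eq
    with refl ← offset-cancel c₁ (trans ceq (offset-column d d≤m)) =
    ℕ.m∸n≤m m d , trans ceq (cong (λ z → cₘ ℤ.- + z) (sym (ℕ.m∸[m∸n]≡n d≤m)))

  f : ℕ → ℕ → Bool
  f i j = is-just (F (rt ℤ.+ + i , c₁ ℤ.+ + j))

  f-occ : ∀ i j → f i j ≡ true → (j ℕ.≤ m) × (c₁ ℤ.+ + j ≡ cₘ ℤ.- + (m ℕ.∸ j)) × (rt ℤ.+ + i ℤ.< bottom (m ℕ.∸ j))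
  f-occ i j fij = let occ = is-just-true fij ; j≤m , ceq = column-of _ j occ in
    j≤m , ceq , occ⇒ (m ℕ.∸ j) _ (subst (λ c → Occ F (_ , c)) ceq occ)

  f-intro : ∀ i j → j ℕ.≤ m → rt ℤ.+ + i ℤ.< bottom (m ℕ.∸ j) → f i j ≡ true
  f-intro i j j≤m lt = is-just-occ (subst (λ c → Occ F (_ , c))
    (trans (offset-column (m ℕ.∸ j) (ℕ.m∸n≤m m j)) (cong (λ z → c₁ ℤ.+ + z) (ℕ.m∸[m∸n]≡n j≤m)))
    (⇒occ (m ℕ.∸ j) i (ℕ.m∸n≤m m j) lt))

  f-left : ∀ i j → f i (suc j) ≡ true → f i j ≡ true
  f-left i j fij = let j<m , _ , lt = f-occ i (suc j) fij in
    f-intro i j (ℕ.<⇒≤ j<m) (ℤ.<-≤-trans lt (inter-≤ k (ℕ.∸-monoʳ-≤ m (ℕ.n≤1+n j)) (ℕ.m∸n≤m m j)))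

  f-up : ∀ i j → f (suc i) j ≡ true → f i j ≡ true
  f-up i j fij = let j≤m , _ , lt = f-occ (suc i) j fij in
    f-intro i j j≤m (ℤ.<-trans (offset-mono-< rt ℕ.≤-refl) lt)

  rowLength : ℕ → ℕ
  rowLength i = prefixLength (f i) (suc m)

  shape : List ℕ
  shape = applyUpTo rowLength k

  partition : IsPartition shape
  partition i with suc i ℕ.<? k
  ... | yes q rewrite part-applyUpTo rowLength k (suc i) q | part-applyUpTo rowLength k i (ℕ.<⇒≤ q) =
    prefixLength-mono (f (suc i)) (f i) (suc m) (f-up i)
  ... | no ¬q rewrite part-applyUpTo-beyond rowLength k (suc i) (ℕ.≮⇒≥ ¬q) = z≤n

  -- No column starts below `rt` and none has more than `k` cells, so `k` parts are enough for
  -- `shape`.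
  row<k : ∀ i j → f i j ≡ true → i ℕ.< k
  row<k i j fij = let j≤m , _ , lt = f-occ i j fij ; d = m ℕ.∸ j in
    offset-cancel-< rt (ℤ.<-≤-trans lt (ℤ.≤-trans (β≤full (t d) (b d) k)
      (subst (ℤ._≤ rt ℤ.+ + k) (sym (β-all (t d) all-true k (λ _ _ → refl))) (ℤ.+-monoˡ-≤ (+ k) (top≤ d (ℕ.m∸n≤m m j))))))

  inShape : ∀ e → Occ F e ⇔ InSkew shape [] rt c₁ e
  inShape (r , c) = mk⇔ to from
    where
    to : Occ F (r , c) → InSkew shape [] rt c₁ (r , c)
    to occ@(a , eq) with d , _ , d≤m , _ , ceq , _ ← Rep.sound rep r c a eq
      with refl ← trans ceq (offset-column d d≤m)
      with i , refl ← ≤⇒offset {rt} {r} (ℤ.≮⇒≥ λ r<rt → ¬Any[] (none-above r c occ r<rt)) =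
      i , m ℕ.∸ d , refl , refl , z≤n ,
      subst (m ℕ.∸ d ℕ.<_) (sym (part-applyUpTo rowLength k i (row<k i (m ℕ.∸ d) (is-just-occ occ))))
        (prefixLength-complete (f i) (suc m) (m ℕ.∸ d) (f-left i) (s≤s (ℕ.m∸n≤m m d)) (is-just-occ occ))
    from : InSkew shape [] rt c₁ (r , c) → Occ F (r , c)
    from (i , j , refl , refl , _ , lt) with i ℕ.<? k
    ... | yes i<k = is-just-true (proj₁ (prefixLength-sound (f i) (suc m) j
        (subst (j ℕ.<_) (part-applyUpTo rowLength k i i<k) lt)))
    ... | no ¬i<k with () ← subst (j ℕ.<_) (part-applyUpTo-beyond rowLength k i (ℕ.≮⇒≥ ¬i<k)) lt

  straight : StraightShaped F
  straight = shape , rt , c₁ , partition , inShape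

-- The columns of a given skew tableau.

≤-entry : Maybe ℕ → ℕ → Bool
≤-entry nothing  x = false
≤-entry (just a) x = a ℕ.≤ᵇ x

module Initial (k : ℕ) (F : Filling) (λ′ μ : List ℕ) (r₀ c₀ : ℤ)
               (λ-part : IsPartition λ′) (μ-part : IsPartition μ) (μ⊆λ : μ ⊆ₚ λ′)
               (shape : ∀ e → Occ F e ⇔ InSkew λ′ μ r₀ c₀ e)
               (strict : ColumnStrict F) (entries : EntriesIn k F)
               (c₁ rt : ℤ) (leftmost : LeftmostCol F c₁) (topRow : TopRow F c₁ rt) where

  G : ℕ → ℕ → Maybe ℕ
  G i j = F (r₀ ℤ.+ + i , c₀ ℤ.+ + j)

  G-shape : ∀ {i j a} → G i j ≡ just a → (part μ i ℕ.≤ j) × (j ℕ.< part λ′ i)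
  G-shape {i} {j} eq with i′ , j′ , req , ceq , lo , hi ← Equivalence.to (shape _) (_ , eq)
    with refl ← offset-cancel r₀ req with refl ← offset-cancel c₀ ceq = lo , hi

  G-occ : ∀ {i j} → part μ i ℕ.≤ j → j ℕ.< part λ′ i → ∃[ a ] G i j ≡ just a
  G-occ lo hi = Equivalence.from (shape _) (_ , _ , refl , refl , lo , hi)

  G-row : ∀ {i j a b} → G i j ≡ just a → G i (suc j) ≡ just b → a ℕ.≤ b
  G-row {i} {j} e e′ = proj₁ strict _ _ _ _ e
    (trans (cong (λ z → F (_ , z)) (trans (plus-one (c₀ ℤ.+ + j)) (suc-offset c₀ j))) e′)

  G-col : ∀ {i j a b} → G i j ≡ just a → G (suc i) j ≡ just b → a ℕ.< b
  G-col {i} {j} e e′ = proj₂ strict _ _ _ _ e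
    (trans (cong (λ z → F (z , _)) (trans (plus-one (r₀ ℤ.+ + i)) (suc-offset r₀ i))) e′)

  -- Cells of `μ` count as filled at every level. The counted cells of a column then form an initial
  -- segment whose length locates the boundary; at level 0 this is the top of the column.
  below : ℕ → ℕ → ℕ → Bool
  below j x i = (j ℕ.<ᵇ part μ i) ∨ ≤-entry (G i j) x

  data Below (j x i : ℕ) : Set where
    inner : j ℕ.< part μ i → Below j x i
    entry : ∀ {a} → part μ i ℕ.≤ j → G i j ≡ just a → a ℕ.≤ x → Below j x i

  below-sound : ∀ j x i → below j x i ≡ true → Below j x i
  below-sound j x i eq with j ℕ.<? part μ i
  ... | yes q = inner q
  ... | no ¬q with j ℕ.<ᵇ part μ i in lt | G i j in e
  ...   | true  | _ = ⊥-elim (¬q (ℕ.<ᵇ⇒< j _ (subst Bool.T (sym lt) tt)))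
  ...   | false | just a = entry (ℕ.≮⇒≥ ¬q) e (ℕ.≤ᵇ⇒≤ a x (subst Bool.T (sym eq) tt))

  below-complete : ∀ j x i → Below j x i → below j x i ≡ true
  below-complete j x i (inner q) rewrite Equivalence.to T-≡ (ℕ.<⇒<ᵇ q) = refl
  below-complete j x i (entry {a} _ e q) rewrite e | Equivalence.to T-≡ (ℕ.≤⇒≤ᵇ q) = ∨-zeroʳ _

  Below-left : ∀ {j x i} → Below (suc j) x i → Below j x i
  Below-left (inner q) = inner (ℕ.<⇒≤ q)
  Below-left {j} {x} {i} (entry _ e q) with j ℕ.<? part μ i
  ... | yes p = inner p
  ... | no ¬p with a , e′ ← G-occ (ℕ.≮⇒≥ ¬p) (ℕ.<⇒≤ (proj₂ (G-shape e))) =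
    entry (ℕ.≮⇒≥ ¬p) e′ (ℕ.≤-trans (G-row e′ e) q)

  -- Moving up one row lowers the entry, hence also the level.
  Below-up : ∀ {j x i} → Below j (suc x) (suc i) → Below j x i
  Below-up {j} {x} {i} (inner q) = inner (ℕ.<-≤-trans q (μ-part i))
  Below-up {j} {x} {i} (entry _ e q) with j ℕ.<? part μ i
  ... | yes p = inner p
  ... | no ¬p with a , e′ ← G-occ (ℕ.≮⇒≥ ¬p) (ℕ.<-≤-trans (proj₂ (G-shape e)) (λ-part i)) =
    entry (ℕ.≮⇒≥ ¬p) e′ (ℕ.s≤s⁻¹ (ℕ.≤-trans (G-col e′ e) q))

  Below-suc : ∀ {j x i} → Below j x i → Below j (suc x) i
  Below-suc (inner q) = inner q
  Below-suc (entry p e q) = entry p e (ℕ.m≤n⇒m≤1+n q)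

  rows : ℕ
  rows = length λ′

  N : ℕ → ℕ → ℕ
  N j x = prefixLength (below j x) rows

  N-sound : ∀ {j x i} → i ℕ.< N j x → Below j x i
  N-sound {j} {x} {i} q = below-sound j x i (proj₁ (prefixLength-sound (below j x) rows i q))

  Below-row : ∀ {j x i} → Below j x i → i ℕ.< rows
  Below-row {j} {x} {i} bl with i ℕ.<? rows
  ... | yes q = q
  ... | no ¬q with z ← part-beyond λ′ i (ℕ.≮⇒≥ ¬q) | bl
  ...   | inner q with () ← subst (j ℕ.<_) z (ℕ.<-≤-trans q (μ⊆λ i))
  ...   | entry _ e _ with () ← subst (j ℕ.<_) z (proj₂ (G-shape e))

  N-complete : ∀ {j x i} → Below j x i → i ℕ.< N j x
  N-complete {j} {x} {i} bl = prefixLength-complete (below j x) rows i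
    (λ i eq → below-complete j x i (Below-up (Below-suc (below-sound j x (suc i) eq))))
    (Below-row bl) (below-complete j x i bl)

  N-suc : ∀ j x → N j x ℕ.≤ N j (suc x)
  N-suc j x = prefixLength-mono _ _ rows λ i eq → below-complete j (suc x) i (Below-suc (below-sound j x i eq))

  N-left : ∀ j x → N (suc j) x ℕ.≤ N j x
  N-left j x = prefixLength-mono _ _ rows λ i eq → below-complete j x i (Below-left (below-sound (suc j) x i eq))

  -- By `Below-up` the cell above any cell counted at level `suc x` is already counted at level `x`,
  -- so at most one cell is new.
  N-step : ∀ j x → N j (suc x) ℕ.≤ suc (N j x)
  N-step j x = bound (N j (suc x)) refl
    where
    bound : ∀ n → N j (suc x) ≡ n → n ℕ.≤ suc (N j x)
    bound zero          _  = z≤n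
    bound (suc zero)    _  = s≤s z≤n
    bound (suc (suc i)) eq = s≤s (N-complete (Below-up (N-sound (subst (suc i ℕ.<_) (sym eq) ℕ.≤-refl))))

  bit : ℕ → ℕ → Bool
  bit j x = N j x ℕ.<ᵇ N j (suc x)

  bit-true : ∀ j x → bit j x ≡ true → N j (suc x) ≡ suc (N j x)
  bit-true j x eq = ℕ.≤-antisym (N-step j x) (ℕ.<ᵇ⇒< _ _ (subst Bool.T (sym eq) tt))

  bit-false : ∀ j x → bit j x ≡ false → N j (suc x) ≡ N j x
  bit-false j x eq with N j x ℕ.<? N j (suc x)
  ... | yes q = ⊥-elim (true≢false (trans (sym (Equivalence.to T-≡ (ℕ.<⇒<ᵇ q))) eq))
  ... | no ¬q = ℕ.≤-antisym (ℕ.≮⇒≥ ¬q) (N-suc j x)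

  β-N : ∀ j x → β (r₀ ℤ.+ + N j 0) (bit j) x ≡ r₀ ℤ.+ + N j x
  β-N j zero = refl
  β-N j (suc x) with bit j x in eq
  ... | false = trans (β-N j x) (cong (λ z → r₀ ℤ.+ + z) (sym (bit-false j x eq)))
  ... | true  = trans (cong ℤ.suc (β-N j x)) (trans (suc-offset r₀ (N j x)) (cong (λ z → r₀ ℤ.+ + z) (sym (bit-true j x eq))))

  G⇒bit : ∀ {i j x} → G i j ≡ just (suc x) → (bit j x ≡ true) × (N j x ≡ i)
  G⇒bit {i} {j} {x} e = Equivalence.to T-≡ (ℕ.<⇒<ᵇ (ℕ.≤-<-trans N≤i i<N)) ,
                        ℕ.≤-antisym N≤i (ℕ.s≤s⁻¹ (ℕ.≤-trans i<N (N-step j x)))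
    where
    i<N : i ℕ.< N j (suc x)
    i<N = N-complete (entry (proj₁ (G-shape e)) e ℕ.≤-refl)
    N≤i : N j x ℕ.≤ i
    N≤i = ℕ.≮⇒≥ λ q → not-below (N-sound q)
      where
      not-below : ¬ Below j x i
      not-below (inner q) = ℕ.<-irrefl refl (ℕ.<-≤-trans q (proj₁ (G-shape e)))
      not-below (entry _ e′ q) with refl ← trans (sym e′) e = ℕ.<-irrefl refl q

  bit⇒G : ∀ {j x} → bit j x ≡ true → G (N j x) j ≡ just (suc x)
  bit⇒G {j} {x} eq with N-sound {j} {suc x} (subst (N j x ℕ.<_) (sym (bit-true j x eq)) ℕ.≤-refl)
  ... | inner q = ⊥-elim (ℕ.<-irrefl refl (N-complete {j} {x} (inner q)))
  ... | entry p e q with ℕ.m≤n⇒m<n∨m≡n q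
  ...   | inj₂ refl = e
  ...   | inj₁ (s≤s q′) = ⊥-elim (ℕ.<-irrefl refl (N-complete {j} {x} (entry p e q′)))

  λ-head : ∀ i → part λ′ i ℕ.≤ part λ′ 0
  λ-head zero    = ℕ.≤-refl
  λ-head (suc i) = ℕ.≤-trans (λ-part i) (λ-head i)

  first : ∃[ j₁ ] (c₁ ≡ c₀ ℤ.+ + j₁) × (j₁ ℕ.< part λ′ 0)
  first with i , j , _ , ceq , _ , hi ← Equivalence.to (shape _) (proj₂ (proj₁ leftmost)) =
    j , ceq , ℕ.<-≤-trans hi (λ-head i)

  j₁ : ℕ
  j₁ = proj₁ first

  -- The columns run to the end of the first row of `λ′`. Those at the right end may be empty;
  -- `trim` removes them later.
  m : ℕ
  m = part λ′ 0 ℕ.∸ suc j₁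

  width : suc (j₁ ℕ.+ m) ≡ part λ′ 0
  width = ℕ.m+[n∸m]≡n (proj₂ (proj₂ first))

  cₘ : ℤ
  cₘ = c₁ ℤ.+ + m

  index : ℕ → ℕ
  index d = j₁ ℕ.+ (m ℕ.∸ d)

  column : ∀ d → d ℕ.≤ m → cₘ ℤ.- + d ≡ c₀ ℤ.+ + index d
  column d d≤m = trans (cong₂ (λ u v → (u ℤ.+ + v) ℤ.- + d) (proj₁ (proj₂ first)) (sym (ℕ.m∸n+n≡m d≤m)))
                       (lemma c₀ (+ j₁) (+ (m ℕ.∸ d)) (+ d))
    where
    lemma : ∀ c j e d → ((c ℤ.+ j) ℤ.+ (e ℤ.+ d)) ℤ.- d ≡ c ℤ.+ (j ℤ.+ e)
    lemma = solve-∀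

  t : ℕ → ℤ
  t d = r₀ ℤ.+ + N (index d) 0

  b : ℕ → ℕ → Bool
  b d = bit (index d)

  locate : ∀ {r c a} → F (r , c) ≡ just a →
           ∃[ i ] ∃[ d ] (d ℕ.≤ m) × (r ≡ r₀ ℤ.+ + i) × (c ≡ c₀ ℤ.+ + index d)
  locate {r} {c} eq with i , j , refl , refl , lo , hi ← Equivalence.to (shape _) (_ , eq) =
    i , m ℕ.∸ (j ℕ.∸ j₁) , ℕ.m∸n≤m m (j ℕ.∸ j₁) , refl , cong (λ z → c₀ ℤ.+ + z) (sym Jd)
    where
    j₁≤j : j₁ ℕ.≤ j
    j₁≤j = ℕ.≮⇒≥ λ j<j₁ → nowhere (trans (sym eq) (proj₂ leftmost _ _
             (subst (c₀ ℤ.+ + j ℤ.<_) (sym (proj₁ (proj₂ first))) (offset-mono-< c₀ j<j₁))))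
      where
      nowhere : ∀ {a : ℕ} → ¬ (just a ≡ nothing)
      nowhere ()
    j≤ : j ℕ.≤ j₁ ℕ.+ m
    j≤ = ℕ.s≤s⁻¹ (subst (j ℕ.<_) (sym width) (ℕ.<-≤-trans hi (λ-head i)))
    Jd : index (m ℕ.∸ (j ℕ.∸ j₁)) ≡ j
    Jd = trans (cong (j₁ ℕ.+_) (ℕ.m∸[m∸n]≡n (ℕ.≤-trans (ℕ.∸-monoˡ-≤ j₁ j≤) (ℕ.≤-reflexive (ℕ.m+n∸m≡n j₁ m)))))
               (ℕ.m+[n∸m]≡n j₁≤j)

  rep : Rep k cₘ m t b F
  Rep.sound rep r c a eq with i , d , d≤m , refl , refl ← locate eq | entries _ _ eq
  Rep.sound rep r c (suc x) eq | _ , x<k with bx , refl ← G⇒bit eq =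
    d , x , d≤m , x<k , sym (column d d≤m) , bx , sym (β-N (index d) x) , refl
  Rep.complete rep r c a (d , x , d≤m , x<k , refl , bx , refl , refl) =
    trans (cong₂ (λ u v → F (u , v)) (β-N (index d) x) (column d d≤m)) (bit⇒G bx)

  inter : ∀ d i → d ℕ.< m → β (t d) (b d) i ℤ.≤ β (t (suc d)) (b (suc d)) i
  inter d i d<m = subst₂ ℤ._≤_ (sym (β-N (index d) i)) (sym (β-N (index (suc d)) i))
    (ℤ.+-monoʳ-≤ r₀ (ℤ.+≤+ (subst (λ j → N j i ℕ.≤ N (index (suc d)) i)
      (trans (sym (ℕ.+-suc j₁ (m ℕ.∸ suc d))) (cong (j₁ ℕ.+_) (sym (ℕ.+-∸-assoc 1 d<m)))) (N-left (index (suc d)) i))))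

  c₁-column : cₘ ℤ.- + m ≡ c₁
  c₁-column = lemma c₁ (+ m)
    where
    lemma : ∀ c m → (c ℤ.+ m) ℤ.- m ≡ c
    lemma = solve-∀

  left : ∃[ x ] (x ℕ.< k) × (b m x ≡ true)
  left = let (r , a , eq) , _ = leftmost
             x , _ , x<k , bx , _ = Rep.sound-at rep m r a (trans (cong (λ c → F (r , c)) c₁-column) eq)
         in x , x<k , bx

  column-top : ∀ {d x} → d ℕ.≤ m → x ℕ.< k → b d x ≡ true → TopRow F (cₘ ℤ.- + d) (t d)
  column-top {d} {x} d≤m x<k bx with y , y≤x , by , yt ← β-first (t d) (b d) x bx =
    (suc y , trans (cong (λ z → F (z , _)) (sym yt)) (Rep.at rep d≤m (ℕ.≤-<-trans y≤x x<k) by)) ,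
    λ r r<t → is-nothing λ a eq →
      let x′ , _ , _ , _ , req , _ = Rep.sound-at rep d r a eq
      in ℤ.<-irrefl refl (ℤ.<-≤-trans r<t (subst (t d ℤ.≤_) (sym req) (β-mono (t d) (b d) {0} {x′} z≤n)))

  top-unique : ∀ {c r r′} → TopRow F c r → TopRow F c r′ → ¬ (r ℤ.< r′)
  top-unique ((a , eq) , _) (_ , none) lt with () ← trans (sym eq) (none _ lt)

  corner : t m ≡ rt
  corner = ℤ.≤-antisym (ℤ.≮⇒≥ (top-unique topRow top)) (ℤ.≮⇒≥ (top-unique top topRow))
    where
    top : TopRow F c₁ (t m)
    top = subst (λ c → TopRow F c (t m)) c₁-column
            (column-top ℕ.≤-refl (proj₁ (proj₂ left)) (proj₂ (proj₂ left)))

  state : State k rt F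
  state = record { cₘ = cₘ ; m = m ; t = t ; b = b ; rep = rep ; inter = inter ; left = left ; corner = corner }

  covered : ∀ L → (∀ c → (c ∈ L) ⇔ (∃[ r ] TopRow F c r × (r ℤ.< rt))) → Above F rt L
  covered L higher r c (a , eq) r<rt with d , x , d≤m , x<k , refl , bx , refl , _ ← Rep.sound rep r c a eq =
    Equivalence.from (higher _) (t d , column-top d≤m x<k bx , ℤ.≤-<-trans (β-mono (t d) (b d) {0} {x} z≤n) r<rt)

theorem7p4 : (k : ℕ) (P : Filling) (j : ℕ) →
    Tableau k P → Nonempty P → NumHigherColumns P j →
    ∃[ Q ] (Iterate (Extract k) j P Q × IsRectification P Q)
theorem7p4 k P j ((λ′ , μ , r₀ , c₀ , λ-part , μ-part , μ⊆λ , shape) , strict , entries) _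
           (c₁ , rt , L , leftmost , topRow , _ , higher , len) =
  let open Initial k P λ′ μ r₀ c₀ λ-part μ-part μ⊆λ shape strict entries c₁ rt leftmost topRow
      Q , iter , st , none-above , kn = iterate k rt j P L state (covered L higher) (ℕ.≤-reflexive len)
      u , u-reading , u≈ = Reading.readingWord state
      v , v-reading , v≈ = Reading.readingWord st
  in Q , iter , Straight.straight st none-above , Reading.columnStrict st ,
     u , v , u-reading , v-reading , ktrans u≈ (ktrans kn (ksym v≈))
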